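{- Let $b,c$ be positive integers with $\gcd(b,c)=2$ and $\frac{b+c}{2}=2^{2l-1}$ for an integer $l\ge 2$. Then: 1. For all nonnegative integers $m,n$ with $2m+n=\frac{2^{2l}-1}{3}$ there is a perfect coloring of $D(m,n)$ with quotient matrix $\begin{pmatrix} c-1 & b\\ c & b-1\end{pmatrix}$. 2. For $m$ with $2m=\frac{2^{2l}+2}{3}$ there is a perfect coloring of $D(m,0)$ with quotient matrix $\begin{pmatrix} c+2 & b\\ c & b+2\end{pmatrix}$.
   Context: The Shrikhande graph is the Cayley graph on $\mathbb{Z}_4^2$ with connection set $\{01,03,10,30,11,33\}$. For nonnegative integers $m,n$, $D(m,n)$ is the Cartesian product of $m$ copies of the Shrikhande graph and $n$ copies of $K_4$ (vertex set $(\mathbb{Z}_4^2)^m\times\mathbb{Z}_4^n$; adjacent iff differing in exactly one coordinate by an adjacency of that factor). A $2$-coloring (surjective map onto colors $\{1,2\}$) is perfect with quotient matrix $(s_{ij})$ if every vertex of color $i$ has exactly $s_{ij}$ neighbours of color $j$. -}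

module Defs where

open import Data.Nat using (ℕ; zero; suc; _+_; _∸_; _≡ᵇ_)
open import Data.Nat.DivMod using (_%_)
open import Data.Fin using (Fin; toℕ)
open import Data.Fin.Properties using (_≟_)
open import Data.Bool using (T; Bool; true; false; _∧_; _∨_; not; if_then_else_)
open import Data.Product using (_×_; _,_; ∃)
open import Data.Vec using (Vec; []; _∷_)
open import Data.List using (List; []; _∷_; concatMap; map; length; filter; allFin)
open import Relation.Nullary.Decidable using (⌊_⌋)
open import Relation.Nullary using (T?)
import Data.Fin as Fin
open import Relation.Binary.PropositionalEquality using (_≡_)

sub4 : Fin 4 → Fin 4 → ℕ
sub4 a b = (toℕ a + 4 ∸ toℕ b) % 4

-- Shrikhande graph: Cayley graph on ℤ₄² with connection set {01,03,10,30,11,33}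
inConn : ℕ → ℕ → Bool
inConn 0 1 = true
inConn 0 3 = true
inConn 1 0 = true
inConn 3 0 = true
inConn 1 1 = true
inConn 3 3 = true
inConn _ _ = false

Z4² : Set
Z4² = Fin 4 × Fin 4

shrAdj : Z4² → Z4² → Bool
shrAdj (x₁ , y₁) (x₂ , y₂) = inConn (sub4 x₁ x₂) (sub4 y₁ y₂)

k4Adj : Fin 4 → Fin 4 → Bool
k4Adj a b = not ⌊ a ≟ b ⌋

eqZ4² : Z4² → Z4² → Bool
eqZ4² (x₁ , y₁) (x₂ , y₂) = ⌊ x₁ ≟ x₂ ⌋ ∧ ⌊ y₁ ≟ y₂ ⌋

V : ℕ → ℕ → Set
V m n = Vec Z4² m × Vec (Fin 4) n

sameAll : {A : Set} {k : ℕ} → (A → A → Bool) → Vec A k → Vec A k → Bool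
sameAll eq [] [] = true
sameAll eq (a ∷ u) (b ∷ v) = eq a b ∧ sameAll eq u v

adjOne : {A : Set} {k : ℕ} → (A → A → Bool) → (A → A → Bool) → Vec A k → Vec A k → Bool
adjOne eq adj [] [] = false
adjOne eq adj (a ∷ u) (b ∷ v) =
  (adj a b ∧ sameAll eq u v) ∨ (eq a b ∧ adjOne eq adj u v)

eqK4 : Fin 4 → Fin 4 → Bool
eqK4 a b = ⌊ a ≟ b ⌋

Dadj : {m n : ℕ} → V m n → V m n → Bool
Dadj (s₁ , k₁) (s₂ , k₂) =
  (adjOne eqZ4² shrAdj s₁ s₂ ∧ sameAll eqK4 k₁ k₂)
  ∨ (sameAll eqZ4² s₁ s₂ ∧ adjOne eqK4 k4Adj k₁ k₂)

allVec : {A : Set} → List A → (k : ℕ) → List (Vec A k)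
allVec xs zero = [] ∷ []
allVec xs (suc k) = concatMap (λ x → map (x ∷_) (allVec xs k)) xs

allZ4² : List Z4²
allZ4² = concatMap (λ x → map (x ,_) (allFin 4)) (allFin 4)

allV : (m n : ℕ) → List (V m n)
allV m n = concatMap (λ s → map (s ,_) (allVec (allFin 4) n)) (allVec allZ4² m)

nbrCount : {m n : ℕ} → (V m n → Fin 2) → V m n → Fin 2 → ℕ
nbrCount {m} {n} χ v j =
  length (filter (λ w → T? (Dadj v w ∧ ⌊ χ w ≟ j ⌋)) (allV m n))

-- the quotient matrix as a function Fin 2 → Fin 2 → ℕ (index 0 = colour 1, 1 = colour 2)
-- χ is a perfect 2-colouring of D(m,n) with quotient matrix S
IsPerfect2 : (m n : ℕ) → (V m n → Fin 2) → (Fin 2 → Fin 2 → ℕ) → Set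
IsPerfect2 m n χ S =
  ((i : Fin 2) → ∃ λ (v : V m n) → χ v ≡ i)
  × ((v : V m n) → (j : Fin 2) → nbrCount χ v j ≡ S (χ v) j)

mat2 : ℕ → ℕ → ℕ → ℕ → Fin 2 → Fin 2 → ℕ
mat2 a b c d Fin.zero Fin.zero = a
mat2 a b c d Fin.zero (Fin.suc Fin.zero) = b
mat2 a b c d (Fin.suc Fin.zero) Fin.zero = c
mat2 a b c d (Fin.suc Fin.zero) (Fin.suc Fin.zero) = d

{-# OPTIONS --safe #-}
module Submission where

-- A group homomorphism φ from the vertices (each factor read as a Cayley graph) to a group H of
-- order 2^(2l-1) shows, around every vertex v, the translate by φ v of one fixed multiset of
-- differences. If this multiset together with 0 covers H exactly twice, then colouring v by
-- whether φ v lies in a fixed c/2-subset of H is perfect with the first matrix; if it covers H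
-- twice and 0 two more times, one obtains the second matrix.
--
-- H is ℤ₂³ × ℤ₂^(2k) or ℤ₄ × ℤ₂ × ℤ₂^(2k) with k = l - 2. A Shrikhande factor contributes a star
-- {±x, ±y, ±(x + y)}, a K₄ factor {x, y, x + y} (exponent 2) or {x, 2x, 3x}. Passing from H to
-- H × ℤ₂², the new elements are covered twice by the stars of ((x , 01) , (θ x , 10)), x ∈ H, for
-- any bijection θ of H such that x ↦ x + θ x is also bijective. In exponent 2 each star is a
-- doubled line and can be traded for two K₄ factors. It remains to cover the group of order 8, by
-- D(2,1), D(1,3), D(3,0) in ℤ₄ × ℤ₂ and by D(0,5) in ℤ₂³; the latter settles n ≥ 5, and n is odd.

open import Defs
open import Level using (0ℓ)
open import Algebra.Bundles using (CommutativeMonoid)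
open import Algebra.Structures using (IsCommutativeMonoid)
import Algebra.Properties.CommutativeMonoid.Mult as Mult
import Algebra.Properties.CommutativeSemigroup as CommutativeSemigroupProperties
open import Data.Bool as Bool using (Bool; T; true; false; _∧_; _∨_; if_then_else_)
open import Data.Nat using (ℕ; zero; suc; _<ᵇ_; _+_; _*_; _∸_; _^_; _≤_; _/_; _%_; NonZero; s≤s; z≤n)
open import Data.Nat.Properties hiding (_≟_)
open import Data.Nat.Divisibility using (_∣_; divides)
open import Data.Nat.GCD using (gcd; gcd[m,n]∣m; gcd[m,n]∣n)
open import Data.Nat.DivMod using (m*n/n≡m; _mod_; m≡m%n+[m/n]*n; m%n<n)
open import Data.Nat.ListAction using (sum)
open import Data.Nat.ListAction.Properties using (sum-++; sum-↭)
open import Data.Nat.Tactic.RingSolver using (solve-∀)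
open import Data.Fin using (Fin; zero; suc; toℕ; combine; remQuot)
open import Data.Fin.Patterns using (0F; 1F; 2F; 3F)
open import Data.Fin.Properties using (_≟_; all?; toℕ-fromℕ<; remQuot-combine)
open import Data.List using (List; []; _∷_; _++_; map; concatMap; cartesianProduct; filter; filterᵇ; take; drop; replicate; length; allFin; tabulate)
open import Data.List.Properties using (++-identityʳ; take++drop≡id; length-take; length-drop; map-∘; map-cong; map-++; length-map; length-++; length-tabulate; map-tabulate) renaming (≡-dec to ≡-decList)
open import Data.List.Membership.Propositional.Properties using (∈-∃++)
import Data.List.Membership.DecPropositional as DecMembership
open import Data.List.Relation.Unary.Any using (here)
open import Data.List.Relation.Unary.All using (All; []; _∷_)
open import Data.List.Relation.Unary.All.Properties using (all-filter)
open import Data.Bool.Properties using (T-∧)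
open import Function.Bundles using (Equivalence)
open import Data.List.Relation.Binary.Permutation.Propositional using (_↭_; ↭-refl; ↭-sym; ↭-trans; prep)
open import Data.List.Relation.Binary.Permutation.Propositional.Properties using (map⁺; shift; drop-∷; ∈-resp-↭; ¬x∷xs↭[])
open import Data.Product using (_×_; _,_; ∃; proj₁; proj₂; uncurry)
open import Data.Product.Properties using (≡-dec)
open import Data.Vec as Vec using (Vec; []; _∷_)
open import Relation.Binary using (DecidableEquality)
open import Relation.Nullary using (Dec; yes; no; T?; contradiction)
open import Relation.Nullary.Decidable using (⌊_⌋; from-yes; True; toWitness; _×-dec_)
open import Relation.Binary.PropositionalEquality using (_≡_; _≢_; refl; sym; trans; cong; cong₂; subst; subst₂; module ≡-Reasoning; isEquivalence)
open import Function using (_∘_; id)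

-- Decidable permutations and finite sums over lists.

private variable
  A B D : Set

-- Each entry of `xs` is cancelled against one occurrence in `ys`. By `shift` and `drop-∷` it does
-- not matter which occurrence is taken, so a failure after a cancellation refutes the original
-- permutation. Concrete multiset identities can then be settled by evaluation.
decPerm : DecidableEquality A → (xs ys : List A) → Dec (xs ↭ ys)
decPerm _≟A_ [] []       = yes ↭-refl
decPerm _≟A_ [] (y ∷ ys) = no (¬x∷xs↭[] ∘ ↭-sym)
decPerm _≟A_ (x ∷ xs) ys with DecMembership._∈?_ _≟A_ x ys
... | no  x∉ys = no λ p → x∉ys (∈-resp-↭ p (here refl))
... | yes x∈ys with ∈-∃++ x∈ys
...   | as , bs , refl with decPerm _≟A_ xs (as ++ bs)
...     | yes p = yes (↭-trans (prep x p) (↭-sym (shift x as bs)))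
...     | no ¬p = no λ p → ¬p (drop-∷ (↭-trans p (shift x as bs)))

∑ : List A → (A → ℕ) → ℕ
∑ xs f = sum (map f xs)

∑-cong : (xs : List A) {f g : A → ℕ} → (∀ x → f x ≡ g x) → ∑ xs f ≡ ∑ xs g
∑-cong xs f≗g = cong sum (map-cong f≗g xs)

∑-++ : (xs ys : List A) (f : A → ℕ) → ∑ (xs ++ ys) f ≡ ∑ xs f + ∑ ys f
∑-++ xs ys f = trans (cong sum (map-++ f xs ys)) (sum-++ (map f xs) (map f ys))

∑-map : (xs : List A) (h : A → B) (f : B → ℕ) → ∑ (map h xs) f ≡ ∑ xs (f ∘ h)
∑-map xs h f = cong sum (sym (map-∘ xs))

∑-concatMap : (xs : List A) (h : A → List B) (f : B → ℕ) →
  ∑ (concatMap h xs) f ≡ ∑ xs λ x → ∑ (h x) f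
∑-concatMap []       h f = refl
∑-concatMap (x ∷ xs) h f =
  trans (∑-++ (h x) (concatMap h xs) f) (cong (∑ (h x) f +_) (∑-concatMap xs h f))

∑-cartesianProduct : (xs : List A) (ys : List B) (f : A × B → ℕ) →
  ∑ (cartesianProduct xs ys) f ≡ ∑ xs λ x → ∑ ys λ y → f (x , y)
∑-cartesianProduct []       ys f = refl
∑-cartesianProduct (x ∷ xs) ys f =
  trans (∑-++ (map (x ,_) ys) (cartesianProduct xs ys) f)
        (cong₂ _+_ (∑-map ys (x ,_) f) (∑-cartesianProduct xs ys f))

∑-cartesianProduct-bijection : (xs : List A) (ys : List B) {σ : A → A} {τ : B → B} →
  (∀ f → ∑ xs (f ∘ σ) ≡ ∑ xs f) → (∀ f → ∑ ys (f ∘ τ) ≡ ∑ ys f) →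
  ∀ f → ∑ (cartesianProduct xs ys) (λ (x , y) → f (σ x , τ y)) ≡ ∑ (cartesianProduct xs ys) f
∑-cartesianProduct-bijection xs ys {σ} {τ} σ-bij τ-bij f = begin
  ∑ (cartesianProduct xs ys) (λ (x , y) → f (σ x , τ y)) ≡⟨ ∑-cartesianProduct xs ys _ ⟩
  ∑ xs (λ x → ∑ ys λ y → f (σ x , τ y)) ≡⟨ ∑-cong xs (λ x → τ-bij λ y → f (σ x , y)) ⟩
  ∑ xs (λ x → ∑ ys λ y → f (σ x , y))   ≡⟨ σ-bij (λ x → ∑ ys λ y → f (x , y)) ⟩
  ∑ xs (λ x → ∑ ys λ y → f (x , y))     ≡⟨ ∑-cartesianProduct xs ys f ⟨
  ∑ (cartesianProduct xs ys) f          ∎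
  where open ≡-Reasoning

length-cartesianProduct : (xs : List A) (ys : List B) →
  length (cartesianProduct xs ys) ≡ length xs * length ys
length-cartesianProduct []       ys = refl
length-cartesianProduct (x ∷ xs) ys =
  trans (length-++ (map (x ,_) ys)) (cong₂ _+_ (length-map (x ,_) ys) (length-cartesianProduct xs ys))

∑-grid : (xs : List A) (ys : List B) (_⟨,⟩_ : A → B → D) (f : D → ℕ) →
  ∑ (concatMap (λ x → map (x ⟨,⟩_) ys) xs) f ≡ ∑ xs λ x → ∑ ys λ y → f (x ⟨,⟩ y)
∑-grid xs ys _⟨,⟩_ f =
  trans (∑-concatMap xs _ f) (∑-cong xs λ x → ∑-map ys (x ⟨,⟩_) f)

∑-+ : (xs : List A) (f g : A → ℕ) → ∑ xs (λ x → f x + g x) ≡ ∑ xs f + ∑ xs g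
∑-+ []       f g = refl
∑-+ (x ∷ xs) f g rewrite ∑-+ xs f g = interchange (f x) (g x) (∑ xs f) (∑ xs g)
  where
  interchange : ∀ a b c d → (a + b) + (c + d) ≡ (a + c) + (b + d)
  interchange = solve-∀

∑-*ˡ : (xs : List A) (c : ℕ) (f : A → ℕ) → ∑ xs (λ x → c * f x) ≡ c * ∑ xs f
∑-*ˡ []       c f = sym (*-zeroʳ c)
∑-*ˡ (x ∷ xs) c f = trans (cong (c * f x +_) (∑-*ˡ xs c f)) (sym (*-distribˡ-+ c (f x) _))

∑-0 : (xs : List A) → ∑ xs (λ _ → 0) ≡ 0
∑-0 []       = refl
∑-0 (x ∷ xs) = ∑-0 xs

∑-↭ : {xs ys : List A} (f : A → ℕ) → xs ↭ ys → ∑ xs f ≡ ∑ ys f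
∑-↭ f p = sum-↭ (map⁺ f p)

𝟙 : Bool → ℕ
𝟙 true  = 1
𝟙 false = 0

𝟙-∧ : ∀ p q → 𝟙 (p ∧ q) ≡ 𝟙 p * 𝟙 q
𝟙-∧ true  q = sym (+-identityʳ (𝟙 q))
𝟙-∧ false q = refl

𝟙-∨ : ∀ p q → p ∧ q ≡ false → 𝟙 (p ∨ q) ≡ 𝟙 p + 𝟙 q
𝟙-∨ true  true  ()
𝟙-∨ true  false _ = refl
𝟙-∨ false q     _ = refl

∑-filterᵇ : (p : A → Bool) (xs : List A) (f : A → ℕ) →
  ∑ (filterᵇ p xs) f ≡ ∑ xs λ x → 𝟙 (p x) * f x
∑-filterᵇ p []       f = refl
∑-filterᵇ p (x ∷ xs) f with p x
... | true  = cong₂ _+_ (sym (+-identityʳ (f x))) (∑-filterᵇ p xs f)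
... | false = ∑-filterᵇ p xs f

-- Neighbourhood sums in Cartesian products of graphs.

-- The two properties that product adjacency relies on: `exclusive` forbids loops, and `singleton`
-- makes `eq a` a Kronecker delta on `xs`.
record IsGraph {A : Set} (eq adj : A → A → Bool) (xs : List A) : Set where
  field
    exclusive : ∀ a b → adj a b ∧ eq a b ≡ false
    singleton : ∀ a (f : A → ℕ) → ∑ xs (λ b → 𝟙 (eq a b) * f b) ≡ f a

module _ {eq₁ adj₁ : A → A → Bool} {xs : List A} (𝒢₁ : IsGraph eq₁ adj₁ xs)
         {eq₂ adj₂ : B → B → Bool} {ys : List B} (𝒢₂ : IsGraph eq₂ adj₂ ys) where
  private
    module G₁ = IsGraph 𝒢₁
    module G₂ = IsGraph 𝒢₂

  □-singleton : ∀ a u (f : A → B → ℕ) →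
    ∑ xs (λ b → ∑ ys λ w → 𝟙 (eq₁ a b ∧ eq₂ u w) * f b w) ≡ f a u
  □-singleton a u f = trans (∑-cong xs inner) (G₁.singleton a λ b → f b u)
    where
    open ≡-Reasoning
    inner : ∀ b → ∑ ys (λ w → 𝟙 (eq₁ a b ∧ eq₂ u w) * f b w) ≡ 𝟙 (eq₁ a b) * f b u
    inner b = begin
      ∑ ys (λ w → 𝟙 (eq₁ a b ∧ eq₂ u w) * f b w)
        ≡⟨ ∑-cong ys (λ w → trans (cong (_* f b w) (𝟙-∧ (eq₁ a b) (eq₂ u w)))
                                  (*-assoc (𝟙 (eq₁ a b)) _ _)) ⟩
      ∑ ys (λ w → 𝟙 (eq₁ a b) * (𝟙 (eq₂ u w) * f b w))
        ≡⟨ ∑-*ˡ ys (𝟙 (eq₁ a b)) _ ⟩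
      𝟙 (eq₁ a b) * ∑ ys (λ w → 𝟙 (eq₂ u w) * f b w)
        ≡⟨ cong (𝟙 (eq₁ a b) *_) (G₂.singleton u (f b)) ⟩
      𝟙 (eq₁ a b) * f b u ∎

  □-exclusive : ∀ a b u w →
    ((adj₁ a b ∧ eq₂ u w) ∨ (eq₁ a b ∧ adj₂ u w)) ∧ (eq₁ a b ∧ eq₂ u w) ≡ false
  □-exclusive a b u w with adj₁ a b | eq₁ a b | adj₂ u w | eq₂ u w | G₁.exclusive a b | G₂.exclusive u w
  ... | true  | true  | _     | _     | () | _
  ... | true  | false | _     | true  | _  | _ = refl
  ... | true  | false | _     | false | _  | _ = refl
  ... | false | true  | true  | true  | _  | ()
  ... | false | true  | true  | false | _  | _ = refl
  ... | false | true  | false | _     | _  | _ = refl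
  ... | false | false | _     | _     | _  | _ = refl

  -- Without loops the two alternatives exclude each other, so the indicator of the disjunction is a
  -- sum. In each half the `eq` factor is a delta that collapses one of the two summations.
  □-neighbours : ∀ a u (f : A → B → ℕ) →
    ∑ xs (λ b → ∑ ys λ w → 𝟙 ((adj₁ a b ∧ eq₂ u w) ∨ (eq₁ a b ∧ adj₂ u w)) * f b w)
    ≡ ∑ xs (λ b → 𝟙 (adj₁ a b) * f b u) + ∑ ys (λ w → 𝟙 (adj₂ u w) * f a w)
  □-neighbours a u f = begin
    ∑ xs (λ b → ∑ ys λ w → 𝟙 ((adj₁ a b ∧ eq₂ u w) ∨ (eq₁ a b ∧ adj₂ u w)) * f b w)
      ≡⟨ ∑-cong xs (λ b → trans (∑-cong ys (split b)) (∑-+ ys _ _)) ⟩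
    ∑ xs (λ b → ∑ ys (λ w → 𝟙 (adj₁ a b) * (𝟙 (eq₂ u w) * f b w))
              + ∑ ys (λ w → 𝟙 (eq₁ a b) * (𝟙 (adj₂ u w) * f b w)))
      ≡⟨ ∑-+ xs _ _ ⟩
    ∑ xs (λ b → ∑ ys λ w → 𝟙 (adj₁ a b) * (𝟙 (eq₂ u w) * f b w))
    + ∑ xs (λ b → ∑ ys λ w → 𝟙 (eq₁ a b) * (𝟙 (adj₂ u w) * f b w))
      ≡⟨ cong₂ _+_
           (∑-cong xs λ b → trans (∑-*ˡ ys (𝟙 (adj₁ a b)) _)
                                  (cong (𝟙 (adj₁ a b) *_) (G₂.singleton u (f b))))
           (trans (∑-cong xs λ b → ∑-*ˡ ys (𝟙 (eq₁ a b)) _)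
                  (G₁.singleton a λ b → ∑ ys λ w → 𝟙 (adj₂ u w) * f b w)) ⟩
    ∑ xs (λ b → 𝟙 (adj₁ a b) * f b u) + ∑ ys (λ w → 𝟙 (adj₂ u w) * f a w) ∎
    where
    open ≡-Reasoning
    disjoint : ∀ b w → (adj₁ a b ∧ eq₂ u w) ∧ (eq₁ a b ∧ adj₂ u w) ≡ false
    disjoint b w with adj₁ a b | eq₁ a b | G₁.exclusive a b
    ... | true  | true  | ()
    ... | false | _     | _ = refl
    ... | true  | false | _ with eq₂ u w
    ...   | true  = refl
    ...   | false = refl
    split : ∀ b w →
      𝟙 ((adj₁ a b ∧ eq₂ u w) ∨ (eq₁ a b ∧ adj₂ u w)) * f b w
      ≡ 𝟙 (adj₁ a b) * (𝟙 (eq₂ u w) * f b w) + 𝟙 (eq₁ a b) * (𝟙 (adj₂ u w) * f b w)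
    split b w
      rewrite 𝟙-∨ (adj₁ a b ∧ eq₂ u w) (eq₁ a b ∧ adj₂ u w) (disjoint b w)
            | 𝟙-∧ (adj₁ a b) (eq₂ u w) | 𝟙-∧ (eq₁ a b) (adj₂ u w)
      = expand (𝟙 (adj₁ a b)) (𝟙 (eq₂ u w)) (𝟙 (eq₁ a b)) (𝟙 (adj₂ u w)) (f b w)
      where
      expand : ∀ p q r s z → (p * q + r * s) * z ≡ p * (q * z) + r * (s * z)
      expand = solve-∀

-- On a nonempty vector `adjOne` and `sameAll` unfold to the adjacency and equality of the product
-- of the first factor with the remaining power.
vecGraph : {eq adj : A → A → Bool} {xs : List A} → IsGraph eq adj xs →
  ∀ k → IsGraph (sameAll eq) (adjOne eq adj) (allVec xs k)
vecGraph 𝒢 zero = record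
  { exclusive = λ { [] [] → refl }
  ; singleton = λ { [] f → trans (+-identityʳ _) (+-identityʳ _) }
  }
vecGraph {xs = xs} 𝒢 (suc k) = record
  { exclusive = λ { (a ∷ u) (b ∷ w) → □-exclusive 𝒢 (vecGraph 𝒢 k) a b u w }
  ; singleton = λ { (a ∷ u) f → trans (∑-grid xs (allVec xs k) _∷_ _)
                                      (□-singleton 𝒢 (vecGraph 𝒢 k) a u λ b w → f (b ∷ w)) }
  }

graph : {eq adj : A → A → Bool} {xs : List A} →
  (∀ a b → adj a b ∧ eq a b ≡ false) → (∀ a → filterᵇ (eq a) xs ≡ a ∷ []) →
  IsGraph eq adj xs
graph {eq = eq} {xs = xs} exclusive single = record
  { exclusive = exclusive
  ; singleton = λ a f → begin
      ∑ xs (λ b → 𝟙 (eq a b) * f b) ≡⟨ ∑-filterᵇ (eq a) xs f ⟨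
      ∑ (filterᵇ (eq a) xs) f       ≡⟨ cong (λ ys → ∑ ys f) (single a) ⟩
      f a + 0                       ≡⟨ +-identityʳ (f a) ⟩
      f a                           ∎
  }
  where open ≡-Reasoning

-- The Shrikhande graph and K₄ as Cayley graphs.

_≟²_ : DecidableEquality Z4²
_≟²_ = ≡-dec _≟_ _≟_

shrikhandeGraph : IsGraph eqZ4² shrAdj allZ4²
shrikhandeGraph = graph
  (λ (a , b) (c , d) → from-yes (all? λ a → all? λ b → all? λ c → all? λ d →
    shrAdj (a , b) (c , d) ∧ eqZ4² (a , b) (c , d) Bool.≟ false) a b c d)
  (λ (a , b) → from-yes (all? λ a → all? λ b →
    ≡-decList _≟²_ (filterᵇ (eqZ4² (a , b)) allZ4²) ((a , b) ∷ [])) a b)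

k4Graph : IsGraph eqK4 k4Adj (allFin 4)
k4Graph = graph
  (from-yes (all? λ a → all? λ b → k4Adj a b ∧ eqK4 a b Bool.≟ false))
  (from-yes (all? λ a → ≡-decList _≟_ (filterᵇ (eqK4 a) (allFin 4)) (a ∷ [])))

_⊕_ : ∀ {n} .{{_ : NonZero n}} → Fin n → Fin n → Fin n
_⊕_ {n} i j = (toℕ i + toℕ j) mod n

_⊕²_ : Z4² → Z4² → Z4²
(a , b) ⊕² (c , d) = (a ⊕ c) , (b ⊕ d)

-- Listed in opposite pairs, so that `linear x y` maps it entry by entry to `star x y`.
connection : List Z4²
connection = map (λ (i , j) → (i mod 4) , (j mod 4))
  ((1 , 0) ∷ (3 , 0) ∷ (0 , 1) ∷ (0 , 3) ∷ (1 , 1) ∷ (3 , 3) ∷ [])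

-- Adjacency tests a difference while the right-hand side adds to `a`; the two agree because the
-- connection set is closed under negation. All 16 vertices are checked.
shrikhande-cayley : ∀ a → filterᵇ (shrAdj a) allZ4² ↭ map (a ⊕²_) connection
shrikhande-cayley (a , b) = from-yes (all? λ a → all? λ b →
  decPerm _≟²_ (filterᵇ (shrAdj (a , b)) allZ4²) (map ((a , b) ⊕²_) connection)) a b

-- In this order the binary digits are 10, 01, 11, which `linear x y` sends to x, y, x ∙ y.
nonzero4 : List (Fin 4)
nonzero4 = map (_mod 4) (2 ∷ 1 ∷ 3 ∷ [])

k4-cyclic : ∀ a → filterᵇ (k4Adj a) (allFin 4) ↭ map (a ⊕_) nonzero4
k4-cyclic = from-yes (all? λ a →
  decPerm _≟_ (filterᵇ (k4Adj a) (allFin 4)) (map (a ⊕_) nonzero4))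

-- K₄ as the Cayley graph of ℤ₂², with i ∈ {0,1,2,3} read as the pair of its binary digits.
digits : Fin 4 → Fin 2 × Fin 2
digits = remQuot 2

_⊞_ : Fin 4 → Fin 4 → Fin 4
a ⊞ b = combine (proj₁ (digits a) ⊕ proj₁ (digits b)) (proj₂ (digits a) ⊕ proj₂ (digits b))

digits-⊞ : ∀ a b →
  digits (a ⊞ b) ≡ (proj₁ (digits a) ⊕ proj₁ (digits b) , proj₂ (digits a) ⊕ proj₂ (digits b))
digits-⊞ a b = remQuot-combine _ (proj₂ (digits a) ⊕ proj₂ (digits b))

k4-elementary : ∀ a → filterᵇ (k4Adj a) (allFin 4) ↭ map (a ⊞_) nonzero4
k4-elementary = from-yes (all? λ a →
  decPerm _≟_ (filterᵇ (k4Adj a) (allFin 4)) (map (a ⊞_) nonzero4))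

-- Sums over initial segments, and abelian groups of exponent dividing 4.

∑< : ℕ → (ℕ → ℕ) → ℕ
∑< zero    f = 0
∑< (suc n) f = f 0 + ∑< n (f ∘ suc)

∑<-cong : ∀ n {f g : ℕ → ℕ} → (∀ i → f i ≡ g i) → ∑< n f ≡ ∑< n g
∑<-cong zero    f≗g = refl
∑<-cong (suc n) f≗g = cong₂ _+_ (f≗g 0) (∑<-cong n (f≗g ∘ suc))

∑<-+ : ∀ m n f → ∑< (m + n) f ≡ ∑< m f + ∑< n (f ∘ (m +_))
∑<-+ zero    n f = refl
∑<-+ (suc m) n f = trans (cong (f 0 +_) (∑<-+ m n (f ∘ suc))) (sym (+-assoc (f 0) _ _))

-- Division of the index by `n` with remainder; it matches the mixed-radix `rank` of a direct
-- product.
∑<-* : ∀ m n f → ∑< (m * n) f ≡ ∑< m λ i → ∑< n λ j → f (i * n + j)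
∑<-* zero    n f = refl
∑<-* (suc m) n f = begin
  ∑< (n + m * n) f
    ≡⟨ ∑<-+ n (m * n) f ⟩
  ∑< n f + ∑< (m * n) (f ∘ (n +_))
    ≡⟨ cong (∑< n f +_) (∑<-* m n (f ∘ (n +_))) ⟩
  ∑< n f + ∑< m (λ i → ∑< n λ j → f (n + (i * n + j)))
    ≡⟨ cong (∑< n f +_) (∑<-cong m λ i → ∑<-cong n λ j → cong f (sym (+-assoc n (i * n) j))) ⟩
  ∑< n f + ∑< m (λ i → ∑< n λ j → f (n + i * n + j)) ∎
  where open ≡-Reasoning

∑<-1 : ∀ n → ∑< n (λ _ → 1) ≡ n
∑<-1 zero    = refl
∑<-1 (suc n) = cong suc (∑<-1 n)

∑<-0 : ∀ n → ∑< n (λ _ → 0) ≡ 0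
∑<-0 zero    = refl
∑<-0 (suc n) = ∑<-0 n

-- An abelian group of exponent dividing 4, so that -x is 3 · x. The field rank-sum says that
-- rank enumerates the carrier by 0, …, order ∸ 1.
record Group₄ : Set₁ where
  infixl 6 _∙_
  field
    Carrier             : Set
    _∙_                 : Carrier → Carrier → Carrier
    ε                   : Carrier
    isCommutativeMonoid : IsCommutativeMonoid _≡_ _∙_ ε
  commutativeMonoid : CommutativeMonoid 0ℓ 0ℓ
  commutativeMonoid = record { isCommutativeMonoid = isCommutativeMonoid }
  open CommutativeMonoid commutativeMonoid public
    using (assoc; comm; identityˡ; identityʳ; commutativeSemigroup)
  open Mult commutativeMonoid public
    using (×-homo-+; ×-distrib-+; ×-assocˡ) renaming (_×_ to _·_)
  field
    exponent  : ∀ x → 4 · x ≡ ε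
    elements  : List Carrier
    rank      : Carrier → ℕ
    translate : ∀ a (f : Carrier → ℕ) → ∑ elements (λ x → f (a ∙ x)) ≡ ∑ elements f
    negate    : ∀ (f : Carrier → ℕ) → ∑ elements (λ x → f (3 · x)) ≡ ∑ elements f
    rank-sum  : ∀ f → ∑ elements (f ∘ rank) ≡ ∑< (length elements) f

  order : ℕ
  order = length elements

  Elementary : Set
  Elementary = ∀ x → 2 · x ≡ ε

  ·-ε : ∀ n → n · ε ≡ ε
  ·-ε zero    = refl
  ·-ε (suc n) = trans (identityˡ _) (·-ε n)

  -- Reduction modulo `n` removes a multiple of `n`, which acts on `x` as a multiple of n · x = ε.
  -- Hence i ↦ i · x is a homomorphism from ℤₙ.
  ⊕-· : ∀ {n} .{{_ : NonZero n}} x → n · x ≡ ε → ∀ (i j : Fin n) →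
    toℕ (i ⊕ j) · x ≡ toℕ i · x ∙ toℕ j · x
  ⊕-· {n} x n·x≡ε i j = sym (begin
    toℕ i · x ∙ toℕ j · x ≡⟨ ×-homo-+ x (toℕ i) (toℕ j) ⟨
    s · x                     ≡⟨ cong (_· x) (m≡m%n+[m/n]*n s n) ⟩
    (s % n + s / n * n) · x   ≡⟨ ×-homo-+ x (s % n) (s / n * n) ⟩
    (s % n) · x ∙ (s / n * n) · x ≡⟨ cong ((s % n) · x ∙_) (×-assocˡ x (s / n) n) ⟨
    (s % n) · x ∙ (s / n) · (n · x) ≡⟨ cong (λ y → (s % n) · x ∙ (s / n) · y) n·x≡ε ⟩
    (s % n) · x ∙ (s / n) · ε     ≡⟨ cong ((s % n) · x ∙_) (·-ε (s / n)) ⟩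
    (s % n) · x ∙ ε             ≡⟨ identityʳ _ ⟩
    (s % n) · x                 ≡⟨ cong (_· x) (toℕ-fromℕ< (m%n<n s n)) ⟨
    toℕ (i ⊕ j) · x           ∎)
    where
    open ≡-Reasoning
    s = toℕ i + toℕ j

-- The nested sums are the unfolded forms of 4 · a and 3 · a. All laws are quantified over a finite
-- set, so one decision procedure yields both ℤ₂ and ℤ₄.
CyclicLaws : ℕ → Set
CyclicLaws m =
    (∀ (a b c : Fin n) → (a ⊕ b) ⊕ c ≡ a ⊕ (b ⊕ c))
  × (∀ (a : Fin n) → zero ⊕ a ≡ a)
  × (∀ (a : Fin n) → a ⊕ zero ≡ a)
  × (∀ (a b : Fin n) → a ⊕ b ≡ b ⊕ a)
  × (∀ (a : Fin n) → a ⊕ (a ⊕ (a ⊕ (a ⊕ zero))) ≡ zero)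
  × (∀ (a : Fin n) → map (a ⊕_) (allFin n) ↭ allFin n)
  × (map (λ a → a ⊕ (a ⊕ (a ⊕ zero))) (allFin n) ↭ allFin n)
  where
  n = suc m

cyclicLaws? : ∀ m → Dec (CyclicLaws m)
cyclicLaws? m =
    (all? λ a → all? λ b → all? λ c → _ ≟ _)
  ×-dec (all? λ a → _ ≟ _)
  ×-dec (all? λ a → _ ≟ _)
  ×-dec (all? λ a → all? λ b → _ ≟ _)
  ×-dec (all? λ a → _ ≟ _)
  ×-dec (all? λ a → decPerm _≟_ _ _)
  ×-dec decPerm _≟_ _ _

∑-allFin : ∀ n f → ∑ (allFin n) (f ∘ toℕ) ≡ ∑< n f
∑-allFin zero    f = refl
∑-allFin (suc n) f = cong (f 0 +_) (begin
  ∑ (tabulate {n = n} suc) (f ∘ toℕ)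
    ≡⟨ cong (λ is → ∑ is (f ∘ toℕ)) (map-tabulate {n = n} id suc) ⟨
  ∑ (map suc (allFin n)) (f ∘ toℕ)
    ≡⟨ ∑-map (allFin n) suc (f ∘ toℕ) ⟩
  ∑ (allFin n) (f ∘ suc ∘ toℕ)
    ≡⟨ ∑-allFin n (f ∘ suc) ⟩
  ∑< n (f ∘ suc)               ∎)
  where open ≡-Reasoning

cyclic : ∀ m → True (cyclicLaws? m) → Group₄
cyclic m laws with toWitness laws
... | assoc′ , idˡ′ , idʳ′ , comm′ , exponent′ , translate′ , negate′ = record
  { Carrier = Fin (suc m)
  ; _∙_ = _⊕_
  ; ε = zero
  ; isCommutativeMonoid = record
    { isMonoid = record
      { isSemigroup = record
        { isMagma = record { isEquivalence = isEquivalence ; ∙-cong = cong₂ _⊕_ }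
        ; assoc = assoc′
        }
      ; identity = idˡ′ , idʳ′
      }
    ; comm = comm′
    }
  ; exponent  = exponent′
  ; elements  = allFin (suc m)
  ; rank      = toℕ
  ; translate = λ a f → trans (sym (∑-map (allFin (suc m)) (a ⊕_) f)) (∑-↭ f (translate′ a))
  ; negate    = λ f → trans (sym (∑-map (allFin (suc m)) _ f)) (∑-↭ f negate′)
  ; rank-sum  = λ f → trans (∑-allFin (suc m) f)
      (cong (λ n → ∑< n f) (sym (length-tabulate {n = suc m} id)))
  }

ℤ2 ℤ4 : Group₄
ℤ2 = cyclic 1 _
ℤ4 = cyclic 3 _

_⊗_ : Group₄ → Group₄ → Group₄
G ⊗ H = record
  { Carrier = G.Carrier × H.Carrier
  ; _∙_ = _∙_
  ; ε = G.ε , H.ε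
  ; isCommutativeMonoid = isCommutativeMonoid
  ; exponent  = λ (x , y) → trans (·-componentwise 4 x y) (cong₂ _,_ (G.exponent x) (H.exponent y))
  ; elements  = cartesianProduct G.elements H.elements
  ; rank      = rank
  ; translate = λ (a , b) → ∑-cartesianProduct-bijection G.elements H.elements (G.translate a) (H.translate b)
  ; negate    = λ f → trans
      (∑-cong (cartesianProduct G.elements H.elements) λ (x , y) → cong f (·-componentwise 3 x y))
      (∑-cartesianProduct-bijection G.elements H.elements G.negate H.negate f)
  ; rank-sum  = rank-sum
  }
  module DirectProduct where
  module G = Group₄ G
  module H = Group₄ H
  open ≡-Reasoning

  _∙_ : G.Carrier × H.Carrier → G.Carrier × H.Carrier → G.Carrier × H.Carrier
  (x , y) ∙ (x′ , y′) = (x G.∙ x′) , (y H.∙ y′)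

  rank : G.Carrier × H.Carrier → ℕ
  rank (x , y) = G.rank x * H.order + H.rank y

  isCommutativeMonoid : IsCommutativeMonoid _≡_ _∙_ (G.ε , H.ε)
  isCommutativeMonoid = record
    { isMonoid = record
      { isSemigroup = record
        { isMagma = record { isEquivalence = isEquivalence ; ∙-cong = cong₂ _∙_ }
        ; assoc = λ (x , y) (x′ , y′) (x″ , y″) → cong₂ _,_ (G.assoc x x′ x″) (H.assoc y y′ y″)
        }
      ; identity = (λ (x , y) → cong₂ _,_ (G.identityˡ x) (H.identityˡ y))
                 , (λ (x , y) → cong₂ _,_ (G.identityʳ x) (H.identityʳ y))
      }
    ; comm = λ (x , y) (x′ , y′) → cong₂ _,_ (G.comm x x′) (H.comm y y′)
    }

  commutativeMonoid : CommutativeMonoid 0ℓ 0ℓ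
  commutativeMonoid = record { isCommutativeMonoid = isCommutativeMonoid }

  open Mult commutativeMonoid using () renaming (_×_ to _·_)

  ·-componentwise : ∀ n x y → n · (x , y) ≡ (n G.· x , n H.· y)
  ·-componentwise zero    x y = refl
  ·-componentwise (suc n) x y = cong ((x , y) ∙_) (·-componentwise n x y)

  rank-sum : ∀ f → ∑ (cartesianProduct G.elements H.elements) (f ∘ rank)
                 ≡ ∑< (length (cartesianProduct G.elements H.elements)) f
  rank-sum f = begin
    ∑ (cartesianProduct G.elements H.elements) (f ∘ rank)
      ≡⟨ ∑-cartesianProduct G.elements H.elements _ ⟩
    ∑ G.elements (λ x → ∑ H.elements λ y → f (G.rank x * H.order + H.rank y))
      ≡⟨ ∑-cong G.elements (λ x → H.rank-sum λ j → f (G.rank x * H.order + j)) ⟩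
    ∑ G.elements (λ x → ∑< H.order λ j → f (G.rank x * H.order + j))
      ≡⟨ G.rank-sum (λ i → ∑< H.order λ j → f (i * H.order + j)) ⟩
    ∑< G.order (λ i → ∑< H.order λ j → f (i * H.order + j))
      ≡⟨ ∑<-* G.order H.order f ⟨
    ∑< (G.order * H.order) f
      ≡⟨ cong (λ n → ∑< n f) (length-cartesianProduct G.elements H.elements) ⟨
    ∑< (length (cartesianProduct G.elements H.elements)) f ∎

-- Local maps to a group and the colourings they induce.

classSize : ℕ → ℕ → Fin 2 → ℕ
classSize c b zero       = c
classSize c b (suc zero) = b

module _ (G : Group₄) where
  open Group₄ G

  -- Testing against arbitrary weights `f` compares multisets irrespective of order, and makes the
  -- contributions of the factors of a product additive.
  record LocalMap {A : Set} (adj : A → A → Bool) (xs : List A) : Set where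
    field
      φ           : A → Carrier
      differences : List Carrier
      neighbours  : ∀ a (f : Carrier → ℕ) →
        ∑ xs (λ b → 𝟙 (adj a b) * f (φ b)) ≡ ∑ differences (λ d → f (φ a ∙ d))

  open LocalMap

  -- A homomorphism `h` carries the neighbourhood a + S to the translate of h[S] by h a. The
  -- argument `ds` allows a simplified form of h[S], free of terms such as 0 · y.
  cayleyMap : {adj : A → A → Bool} {xs : List A} (_+_ : A → A → A) (S : List A) →
    (∀ a → filterᵇ (adj a) xs ↭ map (a +_) S) →
    (h : A → Carrier) → (∀ a b → h (a + b) ≡ h a ∙ h b) →
    (ds : List Carrier) → map h S ≡ ds → LocalMap adj xs
  cayleyMap {adj = adj} {xs} _+_ S cayley h h-+ ds h[S]≡ds = record
    { φ           = h
    ; differences = ds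
    ; neighbours  = λ a f → begin
        ∑ xs (λ b → 𝟙 (adj a b) * f (h b)) ≡⟨ ∑-filterᵇ (adj a) xs (f ∘ h) ⟨
        ∑ (filterᵇ (adj a) xs) (f ∘ h)     ≡⟨ ∑-↭ (f ∘ h) (cayley a) ⟩
        ∑ (map (a +_) S) (f ∘ h)           ≡⟨ ∑-map S (a +_) (f ∘ h) ⟩
        ∑ S (λ b → f (h (a + b)))          ≡⟨ ∑-cong S (λ b → cong f (h-+ a b)) ⟩
        ∑ S (λ b → f (h a ∙ h b))          ≡⟨ ∑-map S h (λ d → f (h a ∙ d)) ⟨
        ∑ (map h S) (λ d → f (h a ∙ d))    ≡⟨ cong (λ ds → ∑ ds _) h[S]≡ds ⟩
        ∑ ds (λ d → f (h a ∙ d))           ∎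
    }
    where open ≡-Reasoning

  ±_ : Carrier → List Carrier
  ± x = x ∷ 3 · x ∷ []

  star : Carrier → Carrier → List Carrier
  star x y = ± x ++ ± y ++ ± (x ∙ y)

  ∑-star : ∀ x y f → ∑ (star x y) f ≡ ∑ (± x) f + (∑ (± y) f + ∑ (± (x ∙ y)) f)
  ∑-star x y f = trans (∑-++ (± x) (± y ++ ± (x ∙ y)) f) (cong (∑ (± x) f +_) (∑-++ (± y) (± (x ∙ y)) f))

  linear : ∀ {m n} → Carrier → Carrier → Fin m × Fin n → Carrier
  linear x y (i , j) = toℕ i · x ∙ toℕ j · y

  linear-⊕ : ∀ {n} .{{_ : NonZero n}} x y → n · x ≡ ε → n · y ≡ ε → ∀ (a b : Fin n × Fin n) →
    linear x y (proj₁ a ⊕ proj₁ b , proj₂ a ⊕ proj₂ b) ≡ linear x y a ∙ linear x y b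
  linear-⊕ x y n·x≡ε n·y≡ε (i , j) (i′ , j′) =
    trans (cong₂ _∙_ (⊕-· x n·x≡ε i i′) (⊕-· y n·y≡ε j j′)) (interchange _ _ _ _)
    where open CommutativeSemigroupProperties commutativeSemigroup using (interchange)

  shrikhande : Carrier → Carrier → LocalMap shrAdj allZ4²
  shrikhande x y = cayleyMap _⊕²_ connection shrikhande-cayley
    (linear x y) (linear-⊕ x y (exponent x) (exponent y)) (star x y)
    (cong₂ _∷_ (trans (identityʳ _) (identityʳ x))
    (cong₂ _∷_ (identityʳ _)
    (cong₂ _∷_ (trans (identityˡ _) (identityʳ y))
    (cong₂ _∷_ (identityˡ _)
    (cong₂ _∷_ (cong₂ _∙_ (identityʳ x) (identityʳ y))
    (cong (_∷ []) (sym (×-distrib-+ x y 3))))))))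

  k4Cyclic : Carrier → LocalMap k4Adj (allFin 4)
  k4Cyclic x = cayleyMap _⊕_ nonzero4 k4-cyclic (λ i → toℕ i · x) (⊕-· x (exponent x)) _ refl

  -- Addition of binary digits without carry is respected because `x` and `y` are killed by 2.
  -- Degenerate pairs, such as those with x = ε, are allowed.
  k4Line : ∀ x y → 2 · x ≡ ε → 2 · y ≡ ε → LocalMap k4Adj (allFin 4)
  k4Line x y 2·x≡ε 2·y≡ε = cayleyMap _⊞_ nonzero4 k4-elementary
    (linear x y ∘ digits)
    (λ a b → trans (cong (linear x y) (digits-⊞ a b))
                   (linear-⊕ x y 2·x≡ε 2·y≡ε (digits a) (digits b)))
    (x ∷ y ∷ (x ∙ y) ∷ [])
    (cong₂ _∷_ (trans (identityʳ _) (identityʳ x))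
    (cong₂ _∷_ (trans (identityˡ _) (identityʳ y))
    (cong (_∷ []) (cong₂ _∙_ (identityʳ x) (identityʳ y)))))

  module _ {eq₁ adj₁ : A → A → Bool} {xs : List A} (𝒢₁ : IsGraph eq₁ adj₁ xs)
           {eq₂ adj₂ : B → B → Bool} {ys : List B} (𝒢₂ : IsGraph eq₂ adj₂ ys)
           (L : LocalMap adj₁ xs) (M : LocalMap adj₂ ys) where

    -- A step in one factor changes only that factor's image; commutativity moves the other image
    -- past the difference, so the two difference lists concatenate.
    □-localMap : ∀ a u (f : Carrier → ℕ) →
      ∑ xs (λ b → ∑ ys λ w →
        𝟙 ((adj₁ a b ∧ eq₂ u w) ∨ (eq₁ a b ∧ adj₂ u w)) * f (φ L b ∙ φ M w))
      ≡ ∑ (differences L ++ differences M) (λ d → f (φ L a ∙ φ M u ∙ d))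
    □-localMap a u f = begin
      ∑ xs (λ b → ∑ ys λ w →
        𝟙 ((adj₁ a b ∧ eq₂ u w) ∨ (eq₁ a b ∧ adj₂ u w)) * f (φ L b ∙ φ M w))
        ≡⟨ □-neighbours 𝒢₁ 𝒢₂ a u (λ b w → f (φ L b ∙ φ M w)) ⟩
      ∑ xs (λ b → 𝟙 (adj₁ a b) * f (φ L b ∙ φ M u)) + ∑ ys (λ w → 𝟙 (adj₂ u w) * f (φ L a ∙ φ M w))
        ≡⟨ cong₂ _+_ (neighbours L a λ x → f (x ∙ φ M u)) (neighbours M u λ x → f (φ L a ∙ x)) ⟩
      ∑ (differences L) (λ d → f (φ L a ∙ d ∙ φ M u))
      + ∑ (differences M) (λ d → f (φ L a ∙ (φ M u ∙ d)))
        ≡⟨ cong₂ _+_ (∑-cong (differences L) λ d → cong f (xy∙z≈xz∙y _ _ _))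
                     (∑-cong (differences M) λ d → cong f (sym (assoc _ _ _))) ⟩
      ∑ (differences L) (λ d → f (φ L a ∙ φ M u ∙ d))
      + ∑ (differences M) (λ d → f (φ L a ∙ φ M u ∙ d))
        ≡⟨ ∑-++ (differences L) (differences M) _ ⟨
      ∑ (differences L ++ differences M) (λ d → f (φ L a ∙ φ M u ∙ d)) ∎
      where
      open ≡-Reasoning
      open CommutativeSemigroupProperties commutativeSemigroup using (xy∙z≈xz∙y)

  powerMap : {eq adj : A → A → Bool} {xs : List A} → IsGraph eq adj xs →
    (Ls : List (LocalMap adj xs)) → LocalMap (adjOne eq adj) (allVec xs (length Ls))
  powerMap 𝒢 [] = record
    { φ = λ _ → ε
    ; differences = []
    ; neighbours = λ { [] f → refl }
    }
  powerMap {eq = eq} {adj} {xs} 𝒢 (L ∷ Ls) = record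
    { φ = λ { (a ∷ u) → φ L a ∙ φ (powerMap 𝒢 Ls) u }
    ; differences = differences L ++ differences (powerMap 𝒢 Ls)
    ; neighbours = λ { (a ∷ u) f →
        trans (∑-grid xs (allVec xs (length Ls)) _∷_ _)
              (□-localMap 𝒢 (vecGraph 𝒢 (length Ls)) L (powerMap 𝒢 Ls) a u f) }
    }

  ∑-powerMap : {eq adj : A → A → Bool} {xs : List A} (𝒢 : IsGraph eq adj xs)
    (Ls : List (LocalMap adj xs)) (f : Carrier → ℕ) →
    ∑ (differences (powerMap 𝒢 Ls)) f ≡ ∑ Ls λ L → ∑ (differences L) f
  ∑-powerMap 𝒢 []       f = refl
  ∑-powerMap 𝒢 (L ∷ Ls) f =
    trans (∑-++ (differences L) _ f) (cong (∑ (differences L) f +_) (∑-powerMap 𝒢 Ls f))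

  doobMap : (Ls : List (LocalMap shrAdj allZ4²)) (Ms : List (LocalMap k4Adj (allFin 4))) →
    LocalMap Dadj (allV (length Ls) (length Ms))
  doobMap Ls Ms = record
    { φ = λ (s , t) → φ L s ∙ φ M t
    ; differences = differences L ++ differences M
    ; neighbours = λ (s , t) f →
        trans (∑-grid (allVec allZ4² (length Ls)) (allVec (allFin 4) (length Ms)) _,_ _)
              (□-localMap (vecGraph shrikhandeGraph (length Ls)) (vecGraph k4Graph (length Ms))
                          L M s t f)
    }
    where
    L = powerMap shrikhandeGraph Ls
    M = powerMap k4Graph Ms

  -- s = 1, t = 0 says that 0 and the differences cover G exactly twice; s = 0, t = 2 says that
  -- the differences cover G twice and 0 two more times.
  Balanced : ℕ → ℕ → List (LocalMap shrAdj allZ4²) → List (LocalMap k4Adj (allFin 4)) → Set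
  Balanced s t Ls Ms = ∀ (f : Carrier → ℕ) →
    ∑ Ls (λ L → ∑ (differences L) f) + ∑ Ms (λ M → ∑ (differences M) f) + s * f ε
    ≡ 2 * ∑ elements f + t * f ε

  -- The covering around ε is moved to `v` by applying the balance to the translate of `f` by the
  -- image of `v`; the total over the group is unchanged by translation.
  balanced-neighbours : ∀ s t Ls Ms → Balanced s t Ls Ms →
    ∀ v (f : Carrier → ℕ) →
    ∑ (allV (length Ls) (length Ms)) (λ w → 𝟙 (Dadj v w) * f (φ (doobMap Ls Ms) w))
      + s * f (φ (doobMap Ls Ms) v)
    ≡ 2 * ∑ elements f + t * f (φ (doobMap Ls Ms) v)
  balanced-neighbours s t Ls Ms balanced v f = begin
    ∑ (allV (length Ls) (length Ms)) (λ w → 𝟙 (Dadj v w) * f (φ (doobMap Ls Ms) w)) + s * f g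
      ≡⟨ cong₂ _+_ (trans (neighbours (doobMap Ls Ms) v f) (∑-++ (differences L) (differences M) _))
                   (cong (λ x → s * f x) (sym (identityʳ g))) ⟩
    ∑ (differences L) (λ d → f (g ∙ d)) + ∑ (differences M) (λ d → f (g ∙ d)) + s * f (g ∙ ε)
      ≡⟨ cong (_+ s * f (g ∙ ε)) (cong₂ _+_ (∑-powerMap shrikhandeGraph Ls _)
                                            (∑-powerMap k4Graph Ms _)) ⟩
    ∑ Ls (λ L → ∑ (differences L) λ d → f (g ∙ d)) + ∑ Ms (λ M → ∑ (differences M) λ d → f (g ∙ d))
      + s * f (g ∙ ε)
      ≡⟨ balanced (λ d → f (g ∙ d)) ⟩
    2 * ∑ elements (λ d → f (g ∙ d)) + t * f (g ∙ ε)
      ≡⟨ cong₂ (λ p x → 2 * p + t * f x) (translate g f) (identityʳ g) ⟩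
    2 * ∑ elements f + t * f g ∎
    where
    open ≡-Reasoning
    L = powerMap shrikhandeGraph Ls
    M = powerMap k4Graph Ms
    g = φ (doobMap Ls Ms) v

  -- Any set of `c` elements would serve; the first `c` in rank order are taken.
  colour : ℕ → Carrier → Fin 2
  colour c x = if rank x <ᵇ c then zero else suc zero

  ∑-colour : ∀ c b → order ≡ c + b → ∀ j →
    ∑ elements (λ x → 𝟙 ⌊ colour c x ≟ j ⌋) ≡ classSize c b j
  ∑-colour c b order≡c+b j = begin
    ∑ elements (λ x → 𝟙 ⌊ colour c x ≟ j ⌋)
      ≡⟨ rank-sum (λ i → 𝟙 ⌊ (if i <ᵇ c then zero else suc zero) ≟ j ⌋) ⟩
    ∑< order (λ i → 𝟙 ⌊ (if i <ᵇ c then zero else suc zero) ≟ j ⌋)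
      ≡⟨ cong (λ n → ∑< n _) order≡c+b ⟩
    ∑< (c + b) (λ i → 𝟙 ⌊ (if i <ᵇ c then zero else suc zero) ≟ j ⌋)
      ≡⟨ threshold c j ⟩
    classSize c b j ∎
    where
    open ≡-Reasoning
    threshold : ∀ c j →
      ∑< (c + b) (λ i → 𝟙 ⌊ (if i <ᵇ c then zero else suc zero) ≟ j ⌋) ≡ classSize c b j
    threshold zero    zero       = ∑<-0 b
    threshold zero    (suc zero) = ∑<-1 b
    threshold (suc c) zero       = cong suc (threshold c zero)
    threshold (suc c) (suc zero) = threshold c (suc zero)

nbrCount-∑ : ∀ {m n} (χ : V m n → Fin 2) v j →
  nbrCount χ v j ≡ ∑ (allV m n) λ w → 𝟙 (Dadj v w) * 𝟙 ⌊ χ w ≟ j ⌋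
nbrCount-∑ {m} {n} χ v j = go (allV m n)
  where
  go : ∀ ws → length (filter (λ w → T? (Dadj v w ∧ ⌊ χ w ≟ j ⌋)) ws)
            ≡ ∑ ws λ w → 𝟙 (Dadj v w) * 𝟙 ⌊ χ w ≟ j ⌋
  go []       = refl
  go (w ∷ ws) with Dadj v w | ⌊ χ w ≟ j ⌋
  ... | true  | true  = cong suc (go ws)
  ... | true  | false = go ws
  ... | false | _     = go ws

-- Here `c` and `b` are the class sizes in the group, half the off-diagonal entries of the quotient
-- matrix. The corrections `s` and `t` stand on opposite sides to avoid subtraction.
HasColouring : ℕ → ℕ → ℕ → ℕ → ℕ → ℕ → Set
HasColouring s t m n c b = ∃ λ (χ : V m n → Fin 2) → ∀ v j →
  nbrCount χ v j + s * 𝟙 ⌊ χ v ≟ j ⌋ ≡ 2 * classSize c b j + t * 𝟙 ⌊ χ v ≟ j ⌋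

-- The balance is applied to the indicator function of a colour class of the group.
balanced⇒colouring : ∀ (G : Group₄) s t Ls Ms → Balanced G s t Ls Ms →
  ∀ c b → Group₄.order G ≡ c + b →
  HasColouring s t (length Ls) (length Ms) c b
balanced⇒colouring G s t Ls Ms balanced c b order≡c+b = χ , count
  where
  open Group₄ G
  open LocalMap (doobMap G Ls Ms) using (φ)
  χ : V (length Ls) (length Ms) → Fin 2
  χ = colour G c ∘ φ
  count : ∀ v j →
    nbrCount χ v j + s * 𝟙 ⌊ χ v ≟ j ⌋ ≡ 2 * classSize c b j + t * 𝟙 ⌊ χ v ≟ j ⌋
  count v j = begin
    nbrCount χ v j + s * 𝟙 ⌊ χ v ≟ j ⌋
      ≡⟨ cong (_+ s * 𝟙 ⌊ χ v ≟ j ⌋) (nbrCount-∑ χ v j) ⟩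
    ∑ (allV (length Ls) (length Ms)) (λ w → 𝟙 (Dadj v w) * 𝟙 ⌊ χ w ≟ j ⌋) + s * 𝟙 ⌊ χ v ≟ j ⌋
      ≡⟨ balanced-neighbours G s t Ls Ms balanced v (λ x → 𝟙 ⌊ colour G c x ≟ j ⌋) ⟩
    2 * ∑ elements (λ x → 𝟙 ⌊ colour G c x ≟ j ⌋) + t * 𝟙 ⌊ χ v ≟ j ⌋
      ≡⟨ cong (λ p → 2 * p + t * 𝟙 ⌊ χ v ≟ j ⌋) (∑-colour G c b order≡c+b j) ⟩
    2 * classSize c b j + t * 𝟙 ⌊ χ v ≟ j ⌋ ∎
    where open ≡-Reasoning

-- Complete mappings.

-- These are the complete mappings of Hall and Paige. They drive the extension step, where x, θ x
-- and x ∙ θ x must each run through the whole group.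
record CompleteMapping (G : Group₄) : Set where
  open Group₄ G
  field
    θ           : Carrier → Carrier
    θ-bijective : ∀ f → ∑ elements (f ∘ θ) ≡ ∑ elements f
    complete    : ∀ f → ∑ elements (λ x → f (x ∙ θ x)) ≡ ∑ elements f

completeMapping⊗ : ∀ G H → CompleteMapping G → CompleteMapping H → CompleteMapping (G ⊗ H)
completeMapping⊗ G H Θ₁ Θ₂ = record
  { θ           = λ (x , y) → Θ₁.θ x , Θ₂.θ y
  ; θ-bijective = ∑-cartesianProduct-bijection G.elements H.elements Θ₁.θ-bijective Θ₂.θ-bijective
  ; complete    = ∑-cartesianProduct-bijection G.elements H.elements Θ₁.complete Θ₂.complete
  }
  where
  module G = Group₄ G
  module H = Group₄ H
  module Θ₁ = CompleteMapping Θ₁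
  module Θ₂ = CompleteMapping Θ₂

module _ (G : Group₄) (_≟G_ : DecidableEquality (Group₄.Carrier G)) where
  open Group₄ G

  decideCompleteMapping : (h : Carrier → Carrier) →
    True (decPerm _≟G_ (map h elements) elements) →
    True (decPerm _≟G_ (map (λ x → x ∙ h x) elements) elements) → CompleteMapping G
  decideCompleteMapping h p q = record
    { θ           = h
    ; θ-bijective = λ f → trans (sym (∑-map elements h f)) (∑-↭ f (toWitness p))
    ; complete    = λ f → trans (sym (∑-map elements _ f)) (∑-↭ f (toWitness q))
    }

ℤ2² ℤ2³ ℤ4×ℤ2 : Group₄
ℤ2²   = ℤ2 ⊗ ℤ2
ℤ2³   = ℤ2 ⊗ ℤ2²
ℤ4×ℤ2 = ℤ4 ⊗ ℤ2

-- Multiplication by a generator of 𝔽₄ˣ.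
ℤ2²-complete : CompleteMapping ℤ2²
ℤ2²-complete = decideCompleteMapping ℤ2² (≡-dec _≟_ _≟_) (λ (a , b) → b , a ⊕ b) _ _

-- Multiplication by a root of X³ + X + 1 in 𝔽₈.
ℤ2³-complete : CompleteMapping ℤ2³
ℤ2³-complete = decideCompleteMapping ℤ2³ (≡-dec _≟_ (≡-dec _≟_ _≟_))
  (λ (a , b , c) → c , a ⊕ c , b) _ _

-- A cyclic group of even order has no complete mapping, so none can be assembled from the factors
-- ℤ₄ and ℤ₂; an explicit table is given.
ℤ4×ℤ2-complete : CompleteMapping ℤ4×ℤ2
ℤ4×ℤ2-complete = decideCompleteMapping ℤ4×ℤ2 (≡-dec _≟_ _≟_) h _ _
  where
  h : Fin 4 × Fin 2 → Fin 4 × Fin 2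
  h (0F , 0F) = 0F , 0F
  h (0F , 1F) = 1F , 0F
  h (1F , 0F) = 1F , 1F
  h (1F , 1F) = 2F , 0F
  h (2F , 0F) = 2F , 1F
  h (2F , 1F) = 3F , 1F
  h (3F , 0F) = 3F , 0F
  h (3F , 1F) = 0F , 1F

-- Extending a group by ℤ₂².

-- The group G × (ℤ₂²)ᵏ, with pairs whose stars cover the complement of ι G exactly twice.
record Extension (G : Group₄) (k : ℕ) : Set₁ where
  private module G = Group₄ G
  field
    group : Group₄
  open Group₄ group
  field
    completeMapping : CompleteMapping group
    ι               : G.Carrier → Carrier
    ι-∙             : ∀ x y → ι (x G.∙ y) ≡ ι x ∙ ι y
    ι-ε             : ι G.ε ≡ ε
    elementary      : G.Elementary → Elementary
    pairs           : List (Carrier × Carrier)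
    order-≡         : order ≡ G.order * 4 ^ k
    pairs-length    : 3 * length pairs + G.order ≡ order
    pairs-sum       : ∀ f → ∑ pairs (λ (x , y) → ∑ (star group x y) f) + 2 * ∑ G.elements (f ∘ ι)
                          ≡ 2 * ∑ elements f

module _ {G k} (E : Extension G k) where
  open Extension E
  open Group₄ group
  open CompleteMapping completeMapping
  private
    module G = Group₄ G
    module K = Group₄ ℤ2²
    H = group ⊗ ℤ2²
    module H = Group₄ H

    embed : Carrier × Carrier → H.Carrier × H.Carrier
    embed (x , y) = (x , 0F , 0F) , (y , 0F , 0F)

    new : Carrier → H.Carrier × H.Carrier
    new x = (x , 0F , 1F) , (θ x , 1F , 0F)

    pairs′ : List (H.Carrier × H.Carrier)
    pairs′ = map embed pairs ++ map new elements

    length-pairs′ : length pairs′ ≡ length pairs + order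
    length-pairs′ = trans (length-++ (map embed pairs))
                          (cong₂ _+_ (length-map embed pairs) (length-map new elements))

    order′ : H.order ≡ order * 4
    order′ = length-cartesianProduct elements (K.elements)

    elementary′ : G.Elementary → H.Elementary
    elementary′ elem (x , y) = trans (DirectProduct.·-componentwise group ℤ2² 2 x y)
      (cong₂ _,_ (elementary elem x)
                 (from-yes (all? λ a → all? λ b → ≡-dec _≟_ _≟_ (K._·_ 2 (a , b)) (0F , 0F))
                   (proj₁ y) (proj₂ y)))

    -- There is one new star for each element of `group`: six differences each, covering three new
    -- cosets twice.
    pairs-length′ : 3 * length pairs′ + G.order ≡ H.order
    pairs-length′ = begin
      3 * length pairs′ + G.order             ≡⟨ cong (λ n → 3 * n + G.order) length-pairs′ ⟩
      3 * (length pairs + order) + G.order    ≡⟨ regroup (length pairs) order G.order ⟩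
      3 * length pairs + G.order + 3 * order  ≡⟨ cong (_+ 3 * order) pairs-length ⟩
      4 * order                               ≡⟨ *-comm 4 order ⟩
      order * 4                               ≡⟨ order′ ⟨
      H.order                                 ∎
      where
      open ≡-Reasoning
      regroup : ∀ p h g → 3 * (p + h) + g ≡ 3 * p + g + 3 * h
      regroup = solve-∀

    3·-componentwise : ∀ x a → 3 H.· (x , a) ≡ (3 · x , a)
    3·-componentwise x (a , b) = trans (DirectProduct.·-componentwise group ℤ2² 3 x (a , b))
      (cong (3 · x ,_)
        (from-yes (all? λ a → all? λ b → ≡-dec _≟_ _≟_ (K._·_ 3 (a , b)) (a , b)) a b))

    -- Negation is the identity on ℤ₂², so an opposite pair stays in one fibre.
    ∑-±-fibre : ∀ x a (f : H.Carrier → ℕ) → ∑ (±_ H (x , a)) f ≡ ∑ (±_ group x) λ x → f (x , a)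
    ∑-±-fibre x a f = cong (λ y → f (x , a) + (f y + 0)) (3·-componentwise x a)

    ∑-star-fibres : ∀ x y a b (f : H.Carrier → ℕ) → ∑ (star H (x , a) (y , b)) f
      ≡ ∑ (±_ group x) (λ x → f (x , a)) + (∑ (±_ group y) (λ y → f (y , b))
        + ∑ (±_ group (x ∙ y)) (λ z → f (z , a K.∙ b)))
    ∑-star-fibres x y a b f = trans (∑-star H (x , a) (y , b) f)
      (cong₂ _+_ (∑-±-fibre x a f) (cong₂ _+_ (∑-±-fibre y b f) (∑-±-fibre (x ∙ y) (a K.∙ b) f)))

    -- As x varies, h x meets every element once, and so does its negative.
    ∑-± : (f : Carrier → ℕ) (h : Carrier → Carrier) →
      (∀ f → ∑ elements (f ∘ h) ≡ ∑ elements f) →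
      ∑ elements (λ x → ∑ (±_ group (h x)) f) ≡ 2 * ∑ elements f
    ∑-± f h h-bijective = begin
      ∑ elements (λ x → ∑ (±_ group (h x)) f)
        ≡⟨ h-bijective (λ x → ∑ (±_ group x) f) ⟩
      ∑ elements (λ x → f x + (f (3 · x) + 0))
        ≡⟨ ∑-+ elements f _ ⟩
      ∑ elements f + ∑ elements (λ x → f (3 · x) + 0)
        ≡⟨ cong (∑ elements f +_) (∑-+ elements (λ x → f (3 · x)) (λ _ → 0)) ⟩
      ∑ elements f + (∑ elements (λ x → f (3 · x)) + ∑ elements (λ _ → 0))
        ≡⟨ cong (∑ elements f +_) (cong₂ _+_ (negate f) (∑-0 elements)) ⟩
      2 * ∑ elements f ∎
      where open ≡-Reasoning

    module _ (f : H.Carrier → ℕ) where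
      open ≡-Reasoning
      f₀₀ f₀₁ f₁₀ f₁₁ : Carrier → ℕ
      f₀₀ x = f (x , 0F , 0F)
      f₀₁ x = f (x , 0F , 1F)
      f₁₀ x = f (x , 1F , 0F)
      f₁₁ x = f (x , 1F , 1F)

      embed-sum : ∑ (map embed pairs) (λ (x , y) → ∑ (star H x y) f)
                ≡ ∑ pairs λ (x , y) → ∑ (star group x y) f₀₀
      embed-sum = trans (∑-map pairs embed _) (∑-cong pairs λ (x , y) →
        trans (∑-star-fibres x y _ _ f) (sym (∑-star group x y f₀₀)))

      -- The three opposite pairs in the star of `new x` lie over 01, 10 and 11 = 01 + 10, with
      -- first coordinates ±x, ±θ x and ±(x ∙ θ x). By completeness of θ each of these three fibres
      -- is covered exactly twice.
      new-sum : ∑ (map new elements) (λ (x , y) → ∑ (star H x y) f)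
              ≡ 2 * ∑ elements f₀₁ + (2 * ∑ elements f₁₀ + 2 * ∑ elements f₁₁)
      new-sum = begin
        ∑ (map new elements) (λ (x , y) → ∑ (star H x y) f)
          ≡⟨ ∑-map elements new _ ⟩
        ∑ elements (λ x → ∑ (star H (x , 0F , 1F) (θ x , 1F , 0F)) f)
          ≡⟨ ∑-cong elements (λ x → ∑-star-fibres x (θ x) (0F , 1F) (1F , 0F) f) ⟩
        ∑ elements (λ x → ∑ (±_ group x) f₀₁
                          + (∑ (±_ group (θ x)) f₁₀ + ∑ (±_ group (x ∙ θ x)) f₁₁))
          ≡⟨ ∑-+ elements (λ x → ∑ (±_ group x) f₀₁) _ ⟩
        ∑ elements (λ x → ∑ (±_ group x) f₀₁)
          + ∑ elements (λ x → ∑ (±_ group (θ x)) f₁₀ + ∑ (±_ group (x ∙ θ x)) f₁₁)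
          ≡⟨ cong₂ _+_ (∑-± f₀₁ id λ _ → refl)
               (trans (∑-+ elements (λ x → ∑ (±_ group (θ x)) f₁₀) _)
                      (cong₂ _+_ (∑-± f₁₀ θ θ-bijective) (∑-± f₁₁ (λ x → x ∙ θ x) complete))) ⟩
        2 * ∑ elements f₀₁ + (2 * ∑ elements f₁₀ + 2 * ∑ elements f₁₁) ∎

      ∑-H : ∑ H.elements f
          ≡ ∑ elements f₀₀ + (∑ elements f₀₁ + (∑ elements f₁₀ + ∑ elements f₁₁))
      ∑-H = begin
        ∑ H.elements f
          ≡⟨ ∑-cartesianProduct elements (K.elements) f ⟩
        ∑ elements (λ x → f₀₀ x + (f₀₁ x + (f₁₀ x + (f₁₁ x + 0))))
          ≡⟨ trans (∑-+ elements f₀₀ _) (cong (∑ elements f₀₀ +_)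
               (trans (∑-+ elements f₀₁ _) (cong (∑ elements f₀₁ +_)
                 (trans (∑-+ elements f₁₀ _) (cong (∑ elements f₁₀ +_)
                   (∑-cong elements λ x → +-identityʳ (f₁₁ x))))))) ⟩
        ∑ elements f₀₀ + (∑ elements f₀₁ + (∑ elements f₁₀ + ∑ elements f₁₁)) ∎

      -- The embedded old stars stay in the fibre over 00 and cover it twice outside the image of G;
      -- the new stars take care of the other three fibres.
      pairs-sum′ : ∑ pairs′ (λ (x , y) → ∑ (star H x y) f) + 2 * ∑ G.elements (f₀₀ ∘ ι)
                 ≡ 2 * ∑ H.elements f
      pairs-sum′ = begin
        ∑ pairs′ (λ (x , y) → ∑ (star H x y) f) + 2 * S
          ≡⟨ cong (_+ 2 * S) (trans (∑-++ (map embed pairs) (map new elements) _)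
                                    (cong₂ _+_ embed-sum new-sum)) ⟩
        P + (2 * S₀₁ + (2 * S₁₀ + 2 * S₁₁)) + 2 * S
          ≡⟨ regroup₁ P (2 * S₀₁ + (2 * S₁₀ + 2 * S₁₁)) (2 * S) ⟩
        P + 2 * S + (2 * S₀₁ + (2 * S₁₀ + 2 * S₁₁))
          ≡⟨ cong (_+ (2 * S₀₁ + (2 * S₁₀ + 2 * S₁₁))) (pairs-sum f₀₀) ⟩
        2 * S₀₀ + (2 * S₀₁ + (2 * S₁₀ + 2 * S₁₁))
          ≡⟨ regroup₂ S₀₀ S₀₁ S₁₀ S₁₁ ⟩
        2 * (S₀₀ + (S₀₁ + (S₁₀ + S₁₁)))
          ≡⟨ cong (2 *_) ∑-H ⟨
        2 * ∑ H.elements f ∎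
        where
        P = ∑ pairs (λ (x , y) → ∑ (star group x y) f₀₀)
        S = ∑ G.elements (f₀₀ ∘ ι)
        S₀₀ = ∑ elements f₀₀
        S₀₁ = ∑ elements f₀₁
        S₁₀ = ∑ elements f₁₀
        S₁₁ = ∑ elements f₁₁
        regroup₁ : ∀ a b c → a + b + c ≡ a + c + b
        regroup₁ = solve-∀
        regroup₂ : ∀ a b c d → 2 * a + (2 * b + (2 * c + 2 * d)) ≡ 2 * (a + (b + (c + d)))
        regroup₂ = solve-∀

  extend : Extension G (suc k)
  extend = record
    { group           = H
    ; completeMapping = completeMapping⊗ group ℤ2² completeMapping ℤ2²-complete
    ; ι               = λ x → ι x , 0F , 0F
    ; ι-∙             = λ x y → cong (_, 0F , 0F) (ι-∙ x y)
    ; ι-ε             = cong (_, 0F , 0F) ι-ε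
    ; elementary      = elementary′
    ; pairs           = pairs′
    ; order-≡         = trans order′ (trans (cong (_* 4) order-≡)
                          (trans (*-assoc G.order (4 ^ k) 4) (cong (G.order *_) (*-comm (4 ^ k) 4))))
    ; pairs-length    = pairs-length′
    ; pairs-sum       = pairs-sum′
    }

extension : ∀ {G} → CompleteMapping G → ∀ k → Extension G k
extension {G} Θ zero = record
  { group           = G
  ; completeMapping = Θ
  ; ι               = id
  ; ι-∙             = λ _ _ → refl
  ; ι-ε             = refl
  ; elementary      = id
  ; pairs           = []
  ; order-≡         = sym (*-identityʳ (Group₄.order G))
  ; pairs-length    = refl
  ; pairs-sum       = λ _ → refl
  }
extension Θ (suc k) = extend (extension Θ k)

-- From a balanced covering of G to one of its extension.

module _ {G k} (E : Extension G k) where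
  open Extension E
  open Group₄ group
  open LocalMap
  private module G = Group₄ G

  lift : {adj : A → A → Bool} {xs : List A} → LocalMap G adj xs → LocalMap group adj xs
  lift {adj = adj} {xs} L = record
    { φ           = ι ∘ φ L
    ; differences = map ι (differences L)
    ; neighbours  = λ a f → begin
        ∑ xs (λ b → 𝟙 (adj a b) * f (ι (φ L b)))
          ≡⟨ neighbours L a (f ∘ ι) ⟩
        ∑ (differences L) (λ d → f (ι (φ L a G.∙ d)))
          ≡⟨ ∑-cong (differences L) (λ d → cong f (ι-∙ (φ L a) d)) ⟩
        ∑ (differences L) (λ d → f (ι (φ L a) ∙ ι d))
          ≡⟨ ∑-map (differences L) ι _ ⟨
        ∑ (map ι (differences L)) (λ d → f (ι (φ L a) ∙ d)) ∎
    }
    where open ≡-Reasoning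

  ∑-lift : {adj : A → A → Bool} {xs : List A} (Ls : List (LocalMap G adj xs)) (f : Carrier → ℕ) →
    ∑ (map lift Ls) (λ L → ∑ (differences L) f) ≡ ∑ Ls λ L → ∑ (differences L) (f ∘ ι)
  ∑-lift Ls f = trans (∑-map Ls lift _) (∑-cong Ls λ L → ∑-map (differences L) ι f)

  starSum : List (Carrier × Carrier) → (Carrier → ℕ) → ℕ
  starSum P f = ∑ P λ (x , y) → ∑ (star group x y) f

  -- The lifted maps cover the image of G as before and the stars cover its complement twice; the
  -- correction at the identity is kept because ι preserves it. Stars in `P` become Shrikhande
  -- factors, while those in `Q` may be realised by any K₄ maps with the same differences.
  extended-balanced : ∀ s t Ls Ms → Balanced G s t Ls Ms →
    ∀ P Q → P ++ Q ≡ pairs →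
    (Ns : List (LocalMap group k4Adj (allFin 4))) →
    (∀ f → ∑ Ns (λ N → ∑ (differences N) f) ≡ starSum Q f) →
    Balanced group s t (map lift Ls ++ map (uncurry (shrikhande group)) P) (map lift Ms ++ Ns)
  extended-balanced s t Ls Ms balanced P Q P++Q≡pairs Ns Ns-sum f = begin
    ∑ (map lift Ls ++ map (uncurry (shrikhande group)) P) (λ L → ∑ (differences L) f)
      + ∑ (map lift Ms ++ Ns) (λ M → ∑ (differences M) f) + s * f ε
      ≡⟨ cong (_+ s * f ε) (cong₂ _+_
           (trans (∑-++ (map lift Ls) _ _) (cong₂ _+_ (∑-lift Ls f) (∑-map P _ _)))
           (trans (∑-++ (map lift Ms) Ns _) (cong₂ _+_ (∑-lift Ms f) (Ns-sum f)))) ⟩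
    (ΣL + starSum P f) + (ΣM + starSum Q f) + s * f ε
      ≡⟨ regroup ΣL (starSum P f) ΣM (starSum Q f) (s * f ε) ⟩
    (ΣL + ΣM + s * f ε) + (starSum P f + starSum Q f)
      ≡⟨ cong₂ _+_ (trans (cong (λ x → ΣL + ΣM + s * f x) (sym ι-ε)) (balanced (f ∘ ι)))
                   (trans (sym (∑-++ P Q _)) (cong (λ R → starSum R f) P++Q≡pairs)) ⟩
    (2 * ∑ G.elements (f ∘ ι) + t * f (ι G.ε)) + starSum pairs f
      ≡⟨ regroup′ (2 * ∑ G.elements (f ∘ ι)) (t * f (ι G.ε)) (starSum pairs f) ⟩
    (starSum pairs f + 2 * ∑ G.elements (f ∘ ι)) + t * f (ι G.ε)
      ≡⟨ cong₂ (λ p x → p + t * f x) (pairs-sum f) ι-ε ⟩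
    2 * ∑ elements f + t * f ε ∎
    where
    open ≡-Reasoning
    ΣL = ∑ Ls λ L → ∑ (differences L) (f ∘ ι)
    ΣM = ∑ Ms λ M → ∑ (differences M) (f ∘ ι)
    regroup : ∀ a b c d e → (a + b) + (c + d) + e ≡ (a + c + e) + (b + d)
    regroup = solve-∀
    regroup′ : ∀ a b c → (a + b) + c ≡ (c + a) + b
    regroup′ = solve-∀

  extended-colouring : ∀ s t Ls Ms → Balanced G s t Ls Ms →
    ∀ P Q → P ++ Q ≡ pairs →
    (Ns : List (LocalMap group k4Adj (allFin 4))) →
    (∀ f → ∑ Ns (λ N → ∑ (differences N) f) ≡ starSum Q f) →
    ∀ c b → order ≡ c + b →
    HasColouring s t (length Ls + length P) (length Ms + length Ns) c b
  extended-colouring s t Ls Ms balanced P Q P++Q≡pairs Ns Ns-sum c b order≡c+b =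
    subst₂ (λ m n → HasColouring s t m n c b)
      (trans (length-++ (map lift Ls))
             (cong₂ _+_ (length-map lift Ls) (length-map (uncurry (shrikhande group)) P)))
      (trans (length-++ (map lift Ms) {Ns}) (cong (_+ length Ns) (length-map lift Ms)))
      (balanced⇒colouring group s t
        (map lift Ls ++ map (uncurry (shrikhande group)) P) (map lift Ms ++ Ns)
        (extended-balanced s t Ls Ms balanced P Q P++Q≡pairs Ns Ns-sum) c b order≡c+b)

  shrikhande-colouring : ∀ s t Ls Ms → Balanced G s t Ls Ms →
    ∀ c b → order ≡ c + b →
    HasColouring s t (length Ls + length pairs) (length Ms + 0) c b
  shrikhande-colouring s t Ls Ms balanced =
    extended-colouring s t Ls Ms balanced pairs [] (++-identityʳ pairs) [] (λ _ → refl)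

  module _ (elem : Elementary) where
    lines : List (Carrier × Carrier) → List (LocalMap group k4Adj (allFin 4))
    lines []            = []
    lines ((x , y) ∷ Q) = line ∷ line ∷ lines Q
      where line = k4Line group x y (elem x) (elem y)

    length-lines : ∀ Q → length (lines Q) ≡ 2 * length Q
    length-lines []      = refl
    length-lines (_ ∷ Q) = trans (cong (2 +_) (length-lines Q)) (sym (*-suc 2 (length Q)))

    3·≡id : ∀ x → 3 · x ≡ x
    3·≡id x = trans (cong (x ∙_) (elem x)) (identityʳ x)

    -- In exponent 2 the star of (x , y) is the line {x , y , x ∙ y} taken twice.
    ∑-lines : ∀ Q f → ∑ (lines Q) (λ N → ∑ (differences N) f) ≡ starSum Q f
    ∑-lines []            f = refl
    ∑-lines ((x , y) ∷ Q) f
      rewrite ∑-lines Q f | 3·≡id x | 3·≡id y | 3·≡id (x ∙ y)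
      = regroup (f x) (f y) (f (x ∙ y)) (starSum Q f)
      where
      regroup : ∀ a b c d → (a + (b + (c + 0))) + ((a + (b + (c + 0))) + d)
                          ≡ (a + (a + (b + (b + (c + (c + 0)))))) + d
      regroup = solve-∀

    -- The first `i` stars remain Shrikhande factors, and each later star is traded for two equal K₄
    -- factors.
    mixed-colouring : ∀ s t Ls Ms → Balanced G s t Ls Ms →
      ∀ i → i ≤ length pairs → ∀ c b → order ≡ c + b →
      HasColouring s t (length Ls + i) (length Ms + 2 * (length pairs ∸ i)) c b
    mixed-colouring s t Ls Ms balanced i i≤p c b order≡c+b =
      subst₂ (λ m n → HasColouring s t m n c b)
        (cong (length Ls +_) (trans (length-take i pairs) (m≤n⇒m⊓n≡m i≤p)))
        (cong (length Ms +_) (trans (length-lines (drop i pairs))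
                                    (cong (2 *_) (length-drop i pairs))))
        (extended-colouring s t Ls Ms balanced (take i pairs) (drop i pairs)
          (take++drop≡id i pairs) (lines (drop i pairs)) (∑-lines (drop i pairs)) c b order≡c+b)

-- Balanced coverings of the groups of order 8.

differencesOf : ∀ {G} {adj : A → A → Bool} {xs} → List (LocalMap G adj xs) → List (Group₄.Carrier G)
differencesOf = concatMap LocalMap.differences

module _ (G : Group₄) (_≟G_ : DecidableEquality (Group₄.Carrier G)) where
  open Group₄ G

  decideBalanced : ∀ s t Ls Ms →
    True (decPerm _≟G_ (differencesOf Ls ++ differencesOf Ms ++ replicate s ε)
                       (elements ++ elements ++ replicate t ε)) →
    Balanced G s t Ls Ms
  decideBalanced s t Ls Ms perm f = begin
    ∑ Ls (λ L → ∑ (differences L) f) + ∑ Ms (λ M → ∑ (differences M) f) + s * f ε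
      ≡⟨ +-assoc (∑ Ls λ L → ∑ (differences L) f) _ _ ⟩
    ∑ Ls (λ L → ∑ (differences L) f) + (∑ Ms (λ M → ∑ (differences M) f) + s * f ε)
      ≡⟨ cong₂ _+_ (∑-concatMap Ls differences f)
           (trans (∑-++ (differencesOf Ms) _ f)
                  (cong₂ _+_ (∑-concatMap Ms differences f) (∑-replicate s))) ⟨
    ∑ (differencesOf Ls) f + ∑ (differencesOf Ms ++ replicate s ε) f
      ≡⟨ ∑-++ (differencesOf Ls) _ f ⟨
    ∑ (differencesOf Ls ++ differencesOf Ms ++ replicate s ε) f
      ≡⟨ ∑-↭ f (toWitness perm) ⟩
    ∑ (elements ++ elements ++ replicate t ε) f
      ≡⟨ trans (∑-++ elements _ f) (cong (∑ elements f +_) (∑-++ elements _ f)) ⟩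
    ∑ elements f + (∑ elements f + ∑ (replicate t ε) f)
      ≡⟨ cong (λ x → ∑ elements f + (∑ elements f + x)) (∑-replicate t) ⟩
    ∑ elements f + (∑ elements f + t * f ε)
      ≡⟨ regroup (∑ elements f) (t * f ε) ⟩
    2 * ∑ elements f + t * f ε ∎
    where
    open ≡-Reasoning
    open LocalMap
    ∑-replicate : ∀ n → ∑ (replicate n ε) f ≡ n * f ε
    ∑-replicate zero    = refl
    ∑-replicate (suc n) = cong (f ε +_) (∑-replicate n)
    regroup : ∀ a b → a + (a + b) ≡ 2 * a + b
    regroup = solve-∀

ℤ2³-elementary : Group₄.Elementary ℤ2³
ℤ2³-elementary (a , b , c) = from-yes (all? λ a → all? λ b → all? λ c →
  ≡-dec _≟_ (≡-dec _≟_ _≟_) (Group₄._·_ ℤ2³ 2 (a , b , c)) (0F , 0F , 0F)) a b c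

-- The degenerate line {0, e, e} with e = (1,0,0), and the four lines of PG(2,2) that miss e.
k4₀₅ : List (LocalMap ℤ2³ k4Adj (allFin 4))
k4₀₅ = map (λ (x , y) → k4Line ℤ2³ x y (ℤ2³-elementary x) (ℤ2³-elementary y))
  ( ((0F , 0F , 0F) , (1F , 0F , 0F))
  ∷ ((0F , 1F , 0F) , (0F , 0F , 1F))
  ∷ ((0F , 1F , 0F) , (1F , 0F , 1F))
  ∷ ((1F , 1F , 0F) , (0F , 0F , 1F))
  ∷ ((1F , 1F , 0F) , (1F , 0F , 1F))
  ∷ [])

balanced₀₅ : Balanced ℤ2³ 1 0 [] k4₀₅
balanced₀₅ = decideBalanced ℤ2³ (≡-dec _≟_ (≡-dec _≟_ _≟_)) 1 0 [] k4₀₅ _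

-- Elements of ℤ₄ × ℤ₂ are written as digit pairs. For D(2,1) the stars cover everything outside
-- {00, 20} twice, and the K₄ map adds 00, 20, 20. For D(1,3) the star gives ±10, ±11, 21, 21; the
-- K₄ maps of 10 and 11 repeat ±10, ±11 and add 20 each, and that of 01 adds 00, 01, 01. For D(3,0)
-- a degenerate star (x, 00) consists of ±x twice and 00 twice, so two of them make up the fourfold
-- 00.
shrikhande₂₁ shrikhande₁₃ shrikhande₃₀ : List (LocalMap ℤ4×ℤ2 shrAdj allZ4²)
shrikhande₂₁ = shrikhande ℤ4×ℤ2 (1F , 0F) (1F , 1F) ∷ shrikhande ℤ4×ℤ2 (1F , 0F) (0F , 1F) ∷ []
shrikhande₁₃ = shrikhande ℤ4×ℤ2 (1F , 0F) (1F , 1F) ∷ []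
shrikhande₃₀ = shrikhande ℤ4×ℤ2 (1F , 0F) (0F , 0F)
             ∷ shrikhande ℤ4×ℤ2 (1F , 1F) (0F , 0F)
             ∷ shrikhande ℤ4×ℤ2 (2F , 0F) (0F , 1F) ∷ []

k4₂₁ k4₁₃ : List (LocalMap ℤ4×ℤ2 k4Adj (allFin 4))
k4₂₁ = k4Cyclic ℤ4×ℤ2 (2F , 0F) ∷ []
k4₁₃ = map (k4Cyclic ℤ4×ℤ2) ((1F , 0F) ∷ (1F , 1F) ∷ (0F , 1F) ∷ [])

balanced₂₁ : Balanced ℤ4×ℤ2 1 0 shrikhande₂₁ k4₂₁
balanced₂₁ = decideBalanced ℤ4×ℤ2 (≡-dec _≟_ _≟_) 1 0 shrikhande₂₁ k4₂₁ _

balanced₁₃ : Balanced ℤ4×ℤ2 1 0 shrikhande₁₃ k4₁₃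
balanced₁₃ = decideBalanced ℤ4×ℤ2 (≡-dec _≟_ _≟_) 1 0 shrikhande₁₃ k4₁₃ _

balanced₃₀ : Balanced ℤ4×ℤ2 0 2 shrikhande₃₀ []
balanced₃₀ = decideBalanced ℤ4×ℤ2 (≡-dec _≟_ _≟_) 0 2 shrikhande₃₀ [] _

-- Colourings for all admissible m and n.

pairs-count : ∀ {G k} (E : Extension G k) r →
  3 * r + Group₄.order G ≡ Group₄.order G * 4 ^ k → length (Extension.pairs E) ≡ r
pairs-count {G} E r eq = *-cancelˡ-≡ _ r 3 (+-cancelʳ-≡ (Group₄.order G) _ _
  (trans (Extension.pairs-length E) (trans (Extension.order-≡ E) (sym eq))))

-- A star has weight 2 in 2m + n, and the base covering has weight 5. The covering of ℤ₂³ already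
-- uses five K₄ factors, so n = 1 and n = 3 are taken from the tower over ℤ₄ × ℤ₂. For n ≥ 5, `m` of
-- the `r` stars of the elementary tower stay Shrikhande.
colouring-part₁ : ∀ k r → 3 * r + 8 ≡ 8 * 4 ^ k → ∀ c b → c + b ≡ 8 * 4 ^ k →
  ∀ m n → 2 * m + n ≡ 5 + 2 * r → HasColouring 1 0 m n c b
colouring-part₁ k r 3r+8≡8*4^k c b c+b≡8*4^k = go
  where
  E = extension ℤ4×ℤ2-complete k
  F = extension ℤ2³-complete k
  module E = Extension E
  module F = Extension F

  length-E : length E.pairs ≡ r
  length-E = pairs-count E r 3r+8≡8*4^k

  length-F : length F.pairs ≡ r
  length-F = pairs-count F r 3r+8≡8*4^k

  order-E : Group₄.order E.group ≡ c + b
  order-E = trans E.order-≡ (sym c+b≡8*4^k)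

  order-F : Group₄.order F.group ≡ c + b
  order-F = trans F.order-≡ (sym c+b≡8*4^k)

  half : ∀ a d e → 2 * a + d ≡ d + 2 * e → a ≡ e
  half a d e eq = *-cancelˡ-≡ a e 2 (+-cancelʳ-≡ d _ _ (trans eq (+-comm d (2 * e))))

  even≢5+ : ∀ a → 2 * a ≢ 5 + 2 * r
  even≢5+ a eq = even≢odd a (2 + r) (trans eq (odd r))
    where
    odd : ∀ r → 5 + 2 * r ≡ suc (2 * (2 + r))
    odd = solve-∀

  go : ∀ m n → 2 * m + n ≡ 5 + 2 * r → HasColouring 1 0 m n c b
  -- For n = 0, 2, 4 the left-hand side is even, whereas 5 + 2r is odd.
  go m 0 eq = contradiction (trans (sym (+-identityʳ _)) eq) (even≢5+ m)
  go m 1 eq = subst (λ m → HasColouring 1 0 m 1 c b)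
    (trans (cong (2 +_) length-E) (sym (half m 1 (2 + r) (trans eq (shape r)))))
    (shrikhande-colouring E 1 0 shrikhande₂₁ k4₂₁ balanced₂₁ c b order-E)
    where
    shape : ∀ r → 5 + 2 * r ≡ 1 + 2 * (2 + r)
    shape = solve-∀
  go m 2 eq = contradiction (trans (*-distribˡ-+ 2 m 1) eq) (even≢5+ (m + 1))
  go m 3 eq = subst (λ m → HasColouring 1 0 m 3 c b)
    (trans (cong (1 +_) length-E) (sym (half m 3 (1 + r) (trans eq (shape r)))))
    (shrikhande-colouring E 1 0 shrikhande₁₃ k4₁₃ balanced₁₃ c b order-E)
    where
    shape : ∀ r → 5 + 2 * r ≡ 3 + 2 * (1 + r)
    shape = solve-∀
  go m 4 eq = contradiction (trans (*-distribˡ-+ 2 m 2) eq) (even≢5+ (m + 2))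
  go m (suc (suc (suc (suc (suc n))))) eq =
    subst (λ n → HasColouring 1 0 m n c b) (cong (5 +_) 2*[p∸m]≡n)
      (mixed-colouring F (F.elementary ℤ2³-elementary) 1 0 [] k4₀₅ balanced₀₅ m m≤p c b order-F)
    where
    open ≡-Reasoning
    2m+n≡2r : 2 * m + n ≡ 2 * r
    2m+n≡2r = +-cancelˡ-≡ 5 _ _ (trans (rotate m n) eq)
      where
      rotate : ∀ m n → 5 + (2 * m + n) ≡ 2 * m + (5 + n)
      rotate = solve-∀
    m≤p : m ≤ length F.pairs
    m≤p = subst (m ≤_) (sym length-F) (*-cancelˡ-≤ 2 (subst (2 * m ≤_) 2m+n≡2r (m≤m+n (2 * m) n)))
    2*[p∸m]≡n : 2 * (length F.pairs ∸ m) ≡ n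
    2*[p∸m]≡n = begin
      2 * (length F.pairs ∸ m) ≡⟨ cong (λ p → 2 * (p ∸ m)) length-F ⟩
      2 * (r ∸ m)              ≡⟨ *-distribˡ-∸ 2 r m ⟩
      2 * r ∸ 2 * m            ≡⟨ cong (_∸ 2 * m) 2m+n≡2r ⟨
      2 * m + n ∸ 2 * m        ≡⟨ m+n∸m≡n (2 * m) n ⟩
      n                        ∎

colouring-part₂ : ∀ k r → 3 * r + 8 ≡ 8 * 4 ^ k → ∀ c b → c + b ≡ 8 * 4 ^ k →
  HasColouring 0 2 (3 + r) 0 c b
colouring-part₂ k r 3r+8≡8*4^k c b c+b≡8*4^k =
  subst (λ r → HasColouring 0 2 (3 + r) 0 c b) (pairs-count E r 3r+8≡8*4^k)
    (shrikhande-colouring E 0 2 shrikhande₃₀ [] balanced₃₀ c b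
      (trans (Extension.order-≡ E) (sym c+b≡8*4^k)))
  where
  E = extension ℤ4×ℤ2-complete k

-- Surjectivity and the quotient matrices.

neighbour-coloured : ∀ {m n} (χ : V m n → Fin 2) v j → 1 ≤ nbrCount χ v j →
  ∃ λ w → χ w ≡ j
neighbour-coloured {m} {n} χ v j positive =
  first (filter P? (allV m n)) (all-filter P? (allV m n)) positive
  where
  P? = λ w → T? (Dadj v w ∧ ⌊ χ w ≟ j ⌋)
  first : ∀ ws → All (λ w → T (Dadj v w ∧ ⌊ χ w ≟ j ⌋)) ws → 1 ≤ length ws → ∃ λ w → χ w ≡ j
  first (w ∷ ws) (p ∷ _) _ = w , toWitness {a? = χ w ≟ j} (proj₂ (Equivalence.to (T-∧ {Dadj v w}) p))

origin : ∀ m n → V m n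
origin m n = Vec.replicate m (0F , 0F) , Vec.replicate n 0F

-- The origin has one of the two colours, and a positive off-diagonal entry gives it a neighbour of
-- the other.
surjective : ∀ {m n} (χ : V m n → Fin 2) → (∀ v j → χ v ≢ j → 1 ≤ nbrCount χ v j) →
  ∀ i → ∃ λ v → χ v ≡ i
surjective {m} {n} χ positive i with χ (origin m n) ≟ i
... | yes χ≡i = origin m n , χ≡i
... | no  χ≢i = neighbour-coloured χ (origin m n) i (positive (origin m n) i χ≢i)

perfect : ∀ {m n c b} (a d : ℕ) (χ : V m n → Fin 2) → 1 ≤ b → 1 ≤ c →
  (∀ v j → nbrCount χ v j ≡ mat2 a b c d (χ v) j) → IsPerfect2 m n χ (mat2 a b c d)
perfect {m} {n} {c} {b} a d χ 1≤b 1≤c counts =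
  surjective χ (λ v j χv≢j → subst (1 ≤_) (sym (counts v j)) (off-diagonal (χ v) j χv≢j)) , counts
  where
  off-diagonal : ∀ i j → i ≢ j → 1 ≤ mat2 a b c d i j
  off-diagonal 0F 0F i≢j = contradiction refl i≢j
  off-diagonal 0F 1F _   = 1≤b
  off-diagonal 1F 0F _   = 1≤c
  off-diagonal 1F 1F i≢j = contradiction refl i≢j

perfect-part₁ : ∀ {m n c b} → 1 ≤ b * 2 → 1 ≤ c * 2 → HasColouring 1 0 m n c b →
  ∃ λ (χ : V m n → Fin 2) → IsPerfect2 m n χ (mat2 (c * 2 ∸ 1) (b * 2) (c * 2) (b * 2 ∸ 1))
perfect-part₁ {c = c} {b} 1≤b 1≤c (χ , counts) = χ , perfect _ _ χ 1≤b 1≤c entry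
  where
  -- The truncated subtraction is exact, since 2x equals N + 1.
  same : ∀ N x → N + 1 ≡ 2 * x + 0 → N ≡ x * 2 ∸ 1
  same N x eq = begin
    N             ≡⟨ m+n∸n≡m N 1 ⟨
    N + 1 ∸ 1     ≡⟨ cong (_∸ 1) eq ⟩
    2 * x + 0 ∸ 1 ≡⟨ cong (_∸ 1) (trans (+-identityʳ (2 * x)) (*-comm 2 x)) ⟩
    x * 2 ∸ 1     ∎
    where open ≡-Reasoning
  other : ∀ N x → N + 0 ≡ 2 * x + 0 → N ≡ x * 2
  other N x eq = trans (+-cancelʳ-≡ 0 N (2 * x) eq) (*-comm 2 x)
  entry : ∀ v j → nbrCount χ v j ≡ mat2 (c * 2 ∸ 1) (b * 2) (c * 2) (b * 2 ∸ 1) (χ v) j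
  entry v j with χ v | j | counts v j
  ... | 0F | 0F | eq = same _ c eq
  ... | 0F | 1F | eq = other _ b eq
  ... | 1F | 0F | eq = other _ c eq
  ... | 1F | 1F | eq = same _ b eq

perfect-part₂ : ∀ {m n c b} → 1 ≤ b * 2 → 1 ≤ c * 2 → HasColouring 0 2 m n c b →
  ∃ λ (χ : V m n → Fin 2) → IsPerfect2 m n χ (mat2 (c * 2 + 2) (b * 2) (c * 2) (b * 2 + 2))
perfect-part₂ {c = c} {b} 1≤b 1≤c (χ , counts) = χ , perfect _ _ χ 1≤b 1≤c entry
  where
  same : ∀ N x → N + 0 ≡ 2 * x + 2 → N ≡ x * 2 + 2
  same N x eq = trans (sym (+-identityʳ N)) (trans eq (cong (_+ 2) (*-comm 2 x)))
  other : ∀ N x → N + 0 ≡ 2 * x + 0 → N ≡ x * 2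
  other N x eq = trans (+-cancelʳ-≡ 0 N (2 * x) eq) (*-comm 2 x)
  entry : ∀ v j → nbrCount χ v j ≡ mat2 (c * 2 + 2) (b * 2) (c * 2) (b * 2 + 2) (χ v) j
  entry v j with χ v | j | counts v j
  ... | 0F | 0F | eq = same _ c eq
  ... | 0F | 1F | eq = other _ b eq
  ... | 1F | 0F | eq = other _ c eq
  ... | 1F | 1F | eq = same _ b eq

-- Arithmetic of the parameters and conclusion.

-- It makes the divisions by 3 exact: the number of stars is (8 · 4^k - 8) / 3 = 8q.
4^k≡1+3q : ∀ k → ∃ λ q → 4 ^ k ≡ 1 + 3 * q
4^k≡1+3q zero    = 0 , refl
4^k≡1+3q (suc k) with 4^k≡1+3q k
... | q , 4^k≡ = 1 + 4 * q , trans (cong (4 *_) 4^k≡) (step q)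
  where
  step : ∀ q → 4 * (1 + 3 * q) ≡ 1 + 3 * (1 + 4 * q)
  step = solve-∀

2^[a+2k] : ∀ a k → 2 ^ (a + 2 * k) ≡ 2 ^ a * 4 ^ k
2^[a+2k] a k = trans (^-distribˡ-+-* 2 a (2 * k)) (cong (2 ^ a *_) (sym (^-*-assoc 2 2 k)))

theorem5 : (b c l : ℕ) → 1 ≤ b → 1 ≤ c → gcd b c ≡ 2 → 2 ≤ l →
    (b + c) / 2 ≡ 2 ^ (2 * l ∸ 1) →
    ((m n : ℕ) → 2 * m + n ≡ (2 ^ (2 * l) ∸ 1) / 3 →
    ∃ λ (χ : V m n → Fin 2) → IsPerfect2 m n χ (mat2 (c ∸ 1) b c (b ∸ 1)))
    × ((m : ℕ) → 2 * m ≡ (2 ^ (2 * l) + 2) / 3 →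
    ∃ λ (χ : V m 0 → Fin 2) → IsPerfect2 m 0 χ (mat2 (c + 2) b c (b + 2)))
theorem5 b c (suc (suc k)) 1≤b 1≤c gcd≡2 (s≤s (s≤s z≤n)) [b+c]/2≡
  -- Here l = 2 + k. The gcd makes `b` and `c` even, and their halves are the class sizes in a group
  -- of order 2^(2l-1) = 8 · 4^k.
  with subst (_∣ b) gcd≡2 (gcd[m,n]∣m b c) | subst (_∣ c) gcd≡2 (gcd[m,n]∣n b c) | 4^k≡1+3q k
... | divides b′ refl | divides c′ refl | q , 4^k≡ =
    (λ m n eq → perfect-part₁ 1≤b 1≤c
      (colouring-part₁ k r 3r+8≡ c′ b′ c′+b′≡ m n (trans eq part₁-degree)))
  , (λ m eq → perfect-part₂ 1≤b 1≤c
      (subst (λ m → HasColouring 0 2 m 0 c′ b′)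
             (*-cancelˡ-≡ (3 + r) m 2 (sym (trans eq part₂-degree)))
             (colouring-part₂ k r 3r+8≡ c′ b′ c′+b′≡)))
  where
  open ≡-Reasoning
  r = 8 * q

  3r+8≡ : 3 * r + 8 ≡ 8 * 4 ^ k
  3r+8≡ = trans (expand q) (cong (8 *_) (sym 4^k≡))
    where
    expand : ∀ q → 3 * (8 * q) + 8 ≡ 8 * (1 + 3 * q)
    expand = solve-∀

  2l≡4+2k : 2 * (2 + k) ≡ 4 + 2 * k
  2l≡4+2k = *-distribˡ-+ 2 2 k

  c′+b′≡ : c′ + b′ ≡ 8 * 4 ^ k
  c′+b′≡ = begin
    c′ + b′                 ≡⟨ +-comm c′ b′ ⟩
    b′ + c′                 ≡⟨ m*n/n≡m (b′ + c′) 2 ⟨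
    (b′ + c′) * 2 / 2       ≡⟨ cong (_/ 2) (*-distribʳ-+ 2 b′ c′) ⟩
    (b′ * 2 + c′ * 2) / 2   ≡⟨ [b+c]/2≡ ⟩
    2 ^ (2 * (2 + k) ∸ 1)   ≡⟨ cong (λ e → 2 ^ (e ∸ 1)) 2l≡4+2k ⟩
    2 ^ (3 + 2 * k)         ≡⟨ 2^[a+2k] 3 k ⟩
    8 * 4 ^ k               ∎

  2^2l≡ : 2 ^ (2 * (2 + k)) ≡ 16 + 48 * q
  2^2l≡ = begin
    2 ^ (2 * (2 + k)) ≡⟨ cong (2 ^_) 2l≡4+2k ⟩
    2 ^ (4 + 2 * k)   ≡⟨ 2^[a+2k] 4 k ⟩
    16 * 4 ^ k        ≡⟨ cong (16 *_) 4^k≡ ⟩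
    16 * (1 + 3 * q)  ≡⟨ expand q ⟩
    16 + 48 * q       ∎
    where
    expand : ∀ q → 16 * (1 + 3 * q) ≡ 16 + 48 * q
    expand = solve-∀

  -- The 5 is the weight of the base coverings D(2,1), D(1,3), D(0,5), to which every star adds 2.
  part₁-degree : (2 ^ (2 * (2 + k)) ∸ 1) / 3 ≡ 5 + 2 * r
  part₁-degree = begin
    (2 ^ (2 * (2 + k)) ∸ 1) / 3 ≡⟨ cong (λ x → (x ∸ 1) / 3) 2^2l≡ ⟩
    (15 + 48 * q) / 3           ≡⟨ cong (_/ 3) (factor q) ⟩
    (5 + 2 * r) * 3 / 3         ≡⟨ m*n/n≡m (5 + 2 * r) 3 ⟩
    5 + 2 * r                   ∎
    where
    factor : ∀ q → 15 + 48 * q ≡ (5 + 2 * (8 * q)) * 3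
    factor = solve-∀

  -- The base covering D(3,0) supplies three Shrikhande factors and each star one more.
  part₂-degree : (2 ^ (2 * (2 + k)) + 2) / 3 ≡ 2 * (3 + r)
  part₂-degree = begin
    (2 ^ (2 * (2 + k)) + 2) / 3 ≡⟨ cong (λ x → (x + 2) / 3) 2^2l≡ ⟩
    (16 + 48 * q + 2) / 3       ≡⟨ cong (_/ 3) (factor q) ⟩
    2 * (3 + r) * 3 / 3         ≡⟨ m*n/n≡m (2 * (3 + r)) 3 ⟩
    2 * (3 + r)                 ∎
    where
    factor : ∀ q → 16 + 48 * q + 2 ≡ 2 * (3 + 8 * q) * 3
    factor = solve-∀
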